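{- For each $m\ge0$ let $\beta_m\in S_{2m}$ be a fixed-point free involution. Then, as formal power series, \[ \sum_{m,j\ge0}c(2j,\beta_m)\frac{z^m}{m!}\frac{u^j}{j!}=\left((1-2z)\sqrt{1-\frac{4zu}{1-2z}}\,\exp\Big(\frac{2zu}{1-2z}\Big)\right)^{ -1}. \]
   Context: $c(k,\beta)$ is the number of $\alpha\in S_{2m}$ with $H(\alpha\beta,\beta\alpha)=k$, where $H(\sigma,\tau)=|\{a:\sigma(a)\ne\tau(a)\}|$ is the Hamming metric; $S_0$ is the trivial group. A fixed-point free involution of $[2m]$ is a product of $m$ disjoint transpositions covering $[2m]$. -}

module Defs where

open import Data.Nat as ℕ using (ℕ; zero; suc; _∸_; _!)
open import Data.Nat.Properties using (_!≢0)
open import Data.Fin using (Fin; _≟_)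
open import Data.Bool using (Bool; true; false; if_then_else_; _∧_)
open import Data.List using (List; map; allFin; foldr)
open import Data.Vec.Functional using (_∷_)
open import Data.Integer using (+_)
open import Data.Rational using (ℚ; 0ℚ; 1ℚ; _+_; _*_; _-_; _/_)
open import Relation.Nullary using (does)
open import Relation.Binary.PropositionalEquality using (_≡_; _≢_)
open import Data.Product using (_×_)

sumFin : ∀ n → (Fin n → ℕ) → ℕ
sumFin n f = foldr ℕ._+_ 0 (map f (allFin n))

sumFun : ∀ k n → ((Fin k → Fin n) → ℕ) → ℕ
sumFun zero    n F = F (λ ())
sumFun (suc k) n F = sumFin n (λ i → sumFun k n (λ g → F (i ∷ g)))

-- boolean test: f is injective (hence a permutation of Fin n)
isPerm : ∀ {n} → (Fin n → Fin n) → Bool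
isPerm {n} f = foldr _∧_ true (map (λ a → foldr _∧_ true (map (λ b →
  if does (a ≟ b) then true else (if does (f a ≟ f b) then false else true))
  (allFin n))) (allFin n))

H : ∀ {n} → (Fin n → Fin n) → (Fin n → Fin n) → ℕ
H {n} σ τ = sumFin n (λ a → if does (σ a ≟ τ a) then 0 else 1)

c : ∀ {n} → ℕ → (Fin n → Fin n) → ℕ
c {n} k β = sumFun n n (λ α →
  if isPerm α then (if does (H (λ a → α (β a)) (λ a → β (α a)) ℕ.≟ k) then 1 else 0)
  else 0)

FPFInvolution : ∀ {n} → (Fin n → Fin n) → Set
FPFInvolution {n} β = (∀ a → β (β a) ≡ a) × (∀ a → β a ≢ a)

-- Formal power series in two variables z, u over ℚ:
-- F m j = coefficient of z^m u^j.

PS : Set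
PS = ℕ → ℕ → ℚ

infix 4 _≈PS_
_≈PS_ : PS → PS → Set
F ≈PS G = ∀ m j → F m j ≡ G m j

sumQ : ℕ → (ℕ → ℚ) → ℚ
sumQ zero    h = h 0
sumQ (suc n) h = sumQ n h + h (suc n)

fromℕQ : ℕ → ℚ
fromℕQ k = (+ k) / 1

invFact : ℕ → ℚ
invFact n = (+ 1) / (n !) where instance _ = n !≢0

oneS : PS
oneS zero zero = 1ℚ
oneS _    _    = 0ℚ

zS : PS
zS 1 0 = 1ℚ
zS _ _ = 0ℚ

uS : PS
uS 0 1 = 1ℚ
uS _ _ = 0ℚ

_+S_ : PS → PS → PS
(F +S G) m j = F m j + G m j

_-S_ : PS → PS → PS
(F -S G) m j = F m j - G m j

_·S_ : ℚ → PS → PS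
(q ·S F) m j = q * F m j

_*S_ : PS → PS → PS
(F *S G) m j = sumQ m (λ a → sumQ j (λ b → F a b * G (m ∸ a) (j ∸ b)))

infixl 6 _+S_ _-S_
infixl 7 _*S_ _·S_

powS : PS → ℕ → PS
powS F zero    = oneS
powS F (suc n) = powS F n *S F

-- exp(A) = Σ_n A^n / n!, for A with zero constant term; the coefficient
-- of z^m u^j only receives contributions from n ≤ m + j.
expS : PS → PS
expS A m j = sumQ (m ℕ.+ j) (λ n → powS A n m j * invFact n)

-- 1/(1 - A) = Σ_n A^n, for A with zero constant term.
geomS : PS → PS
geomS A m j = sumQ (m ℕ.+ j) (λ n → powS A n m j)

two four : ℚ
two  = fromℕQ 2
four = fromℕQ 4

inv1-2z : PS
inv1-2z = geomS (two ·S zS)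

one-2z : PS
one-2z = oneS -S two ·S zS

radicand : PS
radicand = oneS -S four ·S (zS *S uS *S inv1-2z)

expPart : PS
expPart = expS (two ·S (zS *S uS *S inv1-2z))

lhsS : ((m : ℕ) → Fin (2 ℕ.* m) → Fin (2 ℕ.* m)) → PS
lhsS β m j = fromℕQ (c (2 ℕ.* j) (β m)) * invFact m * invFact j

{-# OPTIONS --safe #-}
module Submission where

-- A permutation α commutes with β at a exactly when it commutes with β at β a,
-- and then the two values α a and α (β a) = β (α a) are again exchanged by β.
-- Fixing α at such a pair of points leaves the same problem for 2s - 2 points
-- instead of 2s, so double counting the pairs (α , a) with a a commuting point
-- gives p N(s , p) = (2s)² N(s - 1 , p - 2) for the number N(s , p) of
-- permutations with p commuting points.  Together with Σₚ N(s , p) = (2s)! this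
-- determines N, and hence c(2j , β) = 2ᵐ m! C(m , j) dⱼ, where
-- Σ dⱼ xʲ / j! = (1 - 2x)^{-1/2} e^{-x}.  Summing over m first turns the left-hand
-- side into 1 / (1 - 2z) times this series at x = 2zu / (1 - 2z).
-- To avoid relabelling points, the recursion runs over the permutations of the
-- full point set that extend a prescribed partial injection.

-- Substituting x = 2zu / (1 - 2z) would in general ask for composition of power series. This is
-- avoided by taking u as the outer variable: over ℚ[[z]] the argument is the monomial Yu with Y =
-- 2z / (1 - 2z), so the substitution multiplies the j-th coefficient by Y^j. For this reason power
-- series are built over an arbitrary commutative ring and the construction is applied twice. The
-- one-variable identities behind the square root and the exponential are read off from first-order
-- differential equations, which replaces convolution identities for binomial coefficients. In the
-- count, the recursion is silent at p = 0, where the factor p kills N(s , p). This value is what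
-- the total (2s)! supplies, and it is the source of the factor exp(-x): after normalisation,
-- summing over p multiplies the series of the dⱼ by exp(x) and has to produce (1 - 2x)^(-1/2).

open import Defs

-- Formal power series over a commutative ring.

module PowerSeriesRings where

  open import Data.Nat using (ℕ; zero; suc; _∸_)
  open import Data.Product using (_,_)
  open import Algebra.Bundles using (CommutativeRing)
  open import Relation.Nullary using (contradiction)
  open import Relation.Binary.PropositionalEquality as ≡ using (_≢_)
  import Algebra.Construct.Pointwise as Pointwise
  import Algebra.Properties.Semiring.Exp as SemiringExponentiation
  import Algebra.Solver.Ring.NaturalCoefficients.Default as SemiringSolver
  import Relation.Binary.Reasoning.Setoid as SetoidReasoning

  module PowerSeries {c ℓ} (R : CommutativeRing c ℓ) where

    open CommutativeRing R
    open SemiringExponentiation semiring using (_^_)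
    open SetoidReasoning setoid
    open SemiringSolver commutativeSemiring using (solve; _:+_; _:*_; _:=_)

    Series : Set c
    Series = ℕ → Carrier

    infix 4 _≋_
    _≋_ : Series → Series → Set ℓ
    f ≋ g = ∀ n → f n ≈ g n

    tail : Series → Series
    tail f n = f (suc n)

    infixl 7 _⊛_
    -- The Cauchy product, by recursion on the index with the head of `f` split off. The ring laws
    -- then follow by induction without truncated subtraction; `⊛-coefficient` recovers the usual
    -- sum.
    _⊛_ : Series → Series → Series
    (f ⊛ g) zero    = f 0 * g 0
    (f ⊛ g) (suc n) = f 0 * g (suc n) + (tail f ⊛ g) n

    infixl 6 _⊕_
    _⊕_ : Series → Series → Series
    (f ⊕ g) n = f n + g n

    constS : Carrier → Series
    constS a zero    = a
    constS a (suc _) = 0#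

    ⊛-cong : ∀ {f f′ g g′} → f ≋ f′ → g ≋ g′ → f ⊛ g ≋ f′ ⊛ g′
    ⊛-cong p q zero    = *-cong (p 0) (q 0)
    ⊛-cong p q (suc n) = +-cong (*-cong (p 0) (q (suc n))) (⊛-cong (λ k → p (suc k)) q n)

    ⊛-distribʳ : ∀ h f g → (f ⊕ g) ⊛ h ≋ f ⊛ h ⊕ g ⊛ h
    ⊛-distribʳ h f g zero    = distribʳ (h 0) (f 0) (g 0)
    ⊛-distribʳ h f g (suc n) = begin
      (f 0 + g 0) * h (suc n) + ((tail f ⊕ tail g) ⊛ h) n
        ≈⟨ +-congˡ (⊛-distribʳ h (tail f) (tail g) n) ⟩
      (f 0 + g 0) * h (suc n) + ((tail f ⊛ h) n + (tail g ⊛ h) n)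
        ≈⟨ solve 5 (λ a b c d e → (a :+ b) :* c :+ (d :+ e) := (a :* c :+ d) :+ (b :* c :+ e))
             refl (f 0) (g 0) (h (suc n)) ((tail f ⊛ h) n) ((tail g ⊛ h) n) ⟩
      (f ⊛ h) (suc n) + (g ⊛ h) (suc n) ∎

    ⊛-scaleˡ : ∀ a f g → (λ n → a * f n) ⊛ g ≋ (λ n → a * (f ⊛ g) n)
    ⊛-scaleˡ a f g zero    = *-assoc a (f 0) (g 0)
    ⊛-scaleˡ a f g (suc n) = begin
      a * f 0 * g (suc n) + ((λ k → a * tail f k) ⊛ g) n ≈⟨ +-cong (*-assoc _ _ _) (⊛-scaleˡ a (tail f) g n) ⟩
      a * (f 0 * g (suc n)) + a * (tail f ⊛ g) n         ≈⟨ sym (distribˡ a _ _) ⟩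
      a * (f ⊛ g) (suc n)                                ∎

    -- Mirror image of the defining clause, which splits off the head of the left factor.
    -- Commutativity needs it because the recursion treats the two factors unequally.
    ⊛-snoc : ∀ f g n → (f ⊛ g) (suc n) ≈ (f ⊛ tail g) n + f (suc n) * g 0
    ⊛-snoc f g zero    = refl
    ⊛-snoc f g (suc n) = begin
      f 0 * g (suc (suc n)) + (tail f ⊛ g) (suc n)                      ≈⟨ +-congˡ (⊛-snoc (tail f) g n) ⟩
      f 0 * g (suc (suc n)) + ((tail f ⊛ tail g) n + f (suc (suc n)) * g 0) ≈⟨ sym (+-assoc _ _ _) ⟩
      (f ⊛ tail g) (suc n) + f (suc (suc n)) * g 0                      ∎

    ⊛-comm : ∀ f g → f ⊛ g ≋ g ⊛ f
    ⊛-comm f g zero    = *-comm (f 0) (g 0)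
    ⊛-comm f g (suc n) = begin
      f 0 * g (suc n) + (tail f ⊛ g) n ≈⟨ +-cong (*-comm _ _) (⊛-comm (tail f) g n) ⟩
      g (suc n) * f 0 + (g ⊛ tail f) n ≈⟨ +-comm _ _ ⟩
      (g ⊛ tail f) n + g (suc n) * f 0 ≈⟨ sym (⊛-snoc g f n) ⟩
      (g ⊛ f) (suc n)                  ∎

    ⊛-assoc : ∀ f g h → (f ⊛ g) ⊛ h ≋ f ⊛ (g ⊛ h)
    ⊛-assoc f g h zero    = *-assoc (f 0) (g 0) (h 0)
    ⊛-assoc f g h (suc n) = begin
      -- By definition the tail of `f ⊛ g` is `f 0` times the tail of `g` plus `tail f ⊛ g`.
      f 0 * g 0 * h (suc n) + (((λ k → f 0 * tail g k) ⊕ tail f ⊛ g) ⊛ h) n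
        ≈⟨ +-congˡ (⊛-distribʳ h (λ k → f 0 * tail g k) (tail f ⊛ g) n) ⟩
      f 0 * g 0 * h (suc n) + (((λ k → f 0 * tail g k) ⊛ h) n + ((tail f ⊛ g) ⊛ h) n)
        ≈⟨ +-congˡ (+-cong (⊛-scaleˡ (f 0) (tail g) h n) (⊛-assoc (tail f) g h n)) ⟩
      f 0 * g 0 * h (suc n) + (f 0 * (tail g ⊛ h) n + (tail f ⊛ (g ⊛ h)) n)
        ≈⟨ solve 5 (λ a b c d e → a :* b :* c :+ (a :* d :+ e) := a :* (b :* c :+ d) :+ e)
             refl (f 0) (g 0) (h (suc n)) ((tail g ⊛ h) n) ((tail f ⊛ (g ⊛ h)) n) ⟩
      (f ⊛ (g ⊛ h)) (suc n) ∎

    ⊛-zeroˡ : ∀ g → (λ _ → 0#) ⊛ g ≋ (λ _ → 0#)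
    ⊛-zeroˡ g zero    = zeroˡ (g 0)
    ⊛-zeroˡ g (suc n) = trans (+-cong (zeroˡ _) (⊛-zeroˡ g n)) (+-identityˡ 0#)

    constS-⊛ : ∀ a g → constS a ⊛ g ≋ (λ n → a * g n)
    constS-⊛ a g zero    = refl
    constS-⊛ a g (suc n) = trans (+-congˡ (⊛-zeroˡ g n)) (+-identityʳ _)

    ⊛-identityˡ : ∀ g → constS 1# ⊛ g ≋ g
    ⊛-identityˡ g n = trans (constS-⊛ 1# g n) (*-identityˡ (g n))

    seriesRing : CommutativeRing c ℓ
    seriesRing = record
      { Carrier = Series ; _≈_ = _≋_ ; _+_ = _⊕_ ; _*_ = _⊛_
      ; -_ = λ f n → - f n ; 0# = λ _ → 0# ; 1# = constS 1#
      ; isCommutativeRing = record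
        { isRing = record
          { +-isAbelianGroup = Pointwise.isAbelianGroup ℕ +-isAbelianGroup
          ; *-cong = ⊛-cong
          ; *-assoc = ⊛-assoc
          ; *-identity = ⊛-identityˡ , λ g n → trans (⊛-comm g (constS 1#) n) (⊛-identityˡ g n)
          ; distrib = (λ f g h n → begin
                (f ⊛ (g ⊕ h)) n         ≈⟨ ⊛-comm f (g ⊕ h) n ⟩
                ((g ⊕ h) ⊛ f) n         ≈⟨ ⊛-distribʳ f g h n ⟩
                (g ⊛ f) n + (h ⊛ f) n   ≈⟨ +-cong (⊛-comm g f n) (⊛-comm h f n) ⟩
                (f ⊛ g) n + (f ⊛ h) n   ∎)
              , ⊛-distribʳ
          }
        ; *-comm = ⊛-comm
        }
      }

    sum≤ : ℕ → Series → Carrier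
    sum≤ zero    h = h 0
    sum≤ (suc n) h = sum≤ n h + h (suc n)

    sum≤-cons : ∀ n h → sum≤ (suc n) h ≈ h 0 + sum≤ n (tail h)
    sum≤-cons zero    h = refl
    sum≤-cons (suc n) h = trans (+-congʳ (sum≤-cons n h)) (+-assoc _ _ _)

    ⊛-coefficient : ∀ f g n → (f ⊛ g) n ≈ sum≤ n (λ k → f k * g (n ∸ k))
    ⊛-coefficient f g zero    = refl
    ⊛-coefficient f g (suc n) = begin
      f 0 * g (suc n) + (tail f ⊛ g) n                       ≈⟨ +-congˡ (⊛-coefficient (tail f) g n) ⟩
      f 0 * g (suc n) + sum≤ n (λ k → tail f k * g (n ∸ k))  ≈⟨ sym (sum≤-cons n _) ⟩
      sum≤ (suc n) (λ k → f k * g (suc n ∸ k))               ∎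

    X : Series
    X 1 = 1#
    X _ = 0#

    X-⊛-zero : ∀ f → (X ⊛ f) 0 ≈ 0#
    X-⊛-zero f = zeroˡ (f 0)

    X-⊛-suc : ∀ f n → (X ⊛ f) (suc n) ≈ f n
    X-⊛-suc f n = begin
      0# * f (suc n) + (tail X ⊛ f) n ≈⟨ +-cong (zeroˡ _) (⊛-cong tail-X (λ _ → refl) n) ⟩
      0# + (constS 1# ⊛ f) n          ≈⟨ +-identityˡ _ ⟩
      (constS 1# ⊛ f) n               ≈⟨ ⊛-identityˡ f n ⟩
      f n                             ∎
      where
      tail-X : tail X ≋ constS 1#
      tail-X zero    = refl
      tail-X (suc _) = refl

    -- The substitution f(x) ↦ f(ax).
    rescale : Carrier → Series → Series
    rescale a f n = f n * a ^ n

    rescale-tail : ∀ a f → tail (rescale a f) ≋ (λ n → a * rescale a (tail f) n)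
    rescale-tail a f n =
      solve 3 (λ a b c → b :* (a :* c) := a :* (b :* c)) refl a (f (suc n)) (a ^ n)

    rescale-⊛ : ∀ a f g → rescale a f ⊛ rescale a g ≋ rescale a (f ⊛ g)
    rescale-⊛ a f g zero    =
      trans (*-cong (*-identityʳ _) (*-identityʳ _)) (sym (*-identityʳ _))
    rescale-⊛ a f g (suc n) = begin
      rescale a f 0 * rescale a g (suc n) + (tail (rescale a f) ⊛ rescale a g) n
        ≈⟨ +-congʳ (*-congʳ (*-identityʳ (f 0))) ⟩
      f 0 * rescale a g (suc n) + (tail (rescale a f) ⊛ rescale a g) n
        ≈⟨ +-congˡ (⊛-cong (rescale-tail a f) (λ _ → refl) n) ⟩
      f 0 * rescale a g (suc n) + ((λ k → a * rescale a (tail f) k) ⊛ rescale a g) n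
        ≈⟨ +-congˡ (⊛-scaleˡ a (rescale a (tail f)) (rescale a g) n) ⟩
      f 0 * rescale a g (suc n) + a * (rescale a (tail f) ⊛ rescale a g) n
        ≈⟨ +-congˡ (*-congˡ (rescale-⊛ a (tail f) g n)) ⟩
      f 0 * (g (suc n) * (a * a ^ n)) + a * ((tail f ⊛ g) n * a ^ n)
        ≈⟨ solve 5 (λ a b c d e → b :* (c :* (a :* d)) :+ a :* (e :* d) := (b :* c :+ e) :* (a :* d))
             refl a (f 0) (g (suc n)) (a ^ n) ((tail f ⊛ g) n) ⟩
      rescale a (f ⊛ g) (suc n) ∎

    constS-* : ∀ a b → constS (a * b) ≋ constS a ⊛ constS b
    constS-* a b zero    = refl
    constS-* a b (suc n) = sym (trans (constS-⊛ a (constS b) (suc n)) (zeroʳ a))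

    constS-+ : ∀ a b → constS (a + b) ≋ constS a ⊕ constS b
    constS-+ a b zero    = refl
    constS-+ a b (suc n) = sym (+-identityˡ 0#)

    open SemiringExponentiation (CommutativeRing.semiring seriesRing) using () renaming (_^_ to _^ˢ_)

    monomial : Carrier → Series
    monomial a n = a * X n

    monomial-⊛-zero : ∀ a f → (monomial a ⊛ f) 0 ≈ 0#
    monomial-⊛-zero a f = trans (⊛-scaleˡ a X f 0) (trans (*-congˡ (X-⊛-zero f)) (zeroʳ a))

    monomial-⊛-suc : ∀ a f n → (monomial a ⊛ f) (suc n) ≈ a * f n
    monomial-⊛-suc a f n = trans (⊛-scaleˡ a X f (suc n)) (*-congˡ (X-⊛-suc f n))

    -- The n-th power of ax lives in degree n alone. Together with the next lemma this collapses the
    -- truncated geometric and exponential sums of the statement to a single term.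
    monomial-^-diagonal : ∀ a n → (monomial a ^ˢ n) n ≈ a ^ n
    monomial-^-diagonal a zero    = refl
    monomial-^-diagonal a (suc n) =
      trans (monomial-⊛-suc a (monomial a ^ˢ n) n) (*-congˡ (monomial-^-diagonal a n))

    monomial-^-offDiagonal : ∀ a n k → n ≢ k → (monomial a ^ˢ n) k ≈ 0#
    monomial-^-offDiagonal a zero    zero    n≢k = contradiction ≡.refl n≢k
    monomial-^-offDiagonal a zero    (suc k) n≢k = refl
    monomial-^-offDiagonal a (suc n) zero    n≢k = monomial-⊛-zero a (monomial a ^ˢ n)
    monomial-^-offDiagonal a (suc n) (suc k) n≢k =
      trans (monomial-⊛-suc a (monomial a ^ˢ n) k)
        (trans (*-congˡ (monomial-^-offDiagonal a n k (λ n≡k → n≢k (≡.cong suc n≡k)))) (zeroʳ a))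

  module ConstantCoefficients {c ℓ} (R : CommutativeRing c ℓ) where

    private
      module P = PowerSeries R
      module B = PowerSeries P.seriesRing
    open CommutativeRing P.seriesRing

    -- Base change: every coefficient of `f` becomes a constant series, so that `f` is read as a
    -- series in the outer variable.
    constᶜ : P.Series → B.Series
    constᶜ f n = P.constS (f n)

    constᶜ-⊛ : ∀ f g → constᶜ (f P.⊛ g) B.≋ constᶜ f B.⊛ constᶜ g
    constᶜ-⊛ f g zero    = P.constS-* (f 0) (g 0)
    constᶜ-⊛ f g (suc n) =
      trans (P.constS-+ _ _) (+-cong (P.constS-* (f 0) (g (suc n))) (constᶜ-⊛ (P.tail f) g n))

-- One-variable series over ℚ: exponential and square root through Euler equations.

module RationalSeries where

  open import Data.Nat as ℕ using (ℕ; zero; suc; _!)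
  import Data.Nat.Properties as ℕ
  open import Data.Integer as ℤ using (+_)
  import Data.Integer.Properties as ℤ
  open import Data.Rational using (0ℚ; 1ℚ; _+_; _*_; _-_; -_; _/_; fromℚᵘ)
  open import Data.Rational.Properties
  open import Data.Rational.Unnormalised as ℚᵘ using (mkℚᵘ; *≡*)
  import Data.Rational.Unnormalised.Properties as ℚᵘ
  open import Algebra.Bundles using (CommutativeRing)
  import Algebra.Properties.Ring as RingProperties
  import Algebra.Solver.Ring.NaturalCoefficients.Default as SemiringSolver
  import Relation.Binary.Reasoning.Setoid as SetoidReasoning
  open import Relation.Binary.PropositionalEquality
  open PowerSeriesRings

  -- `_/_` reduces fractions; on unnormalised fractions the same arithmetic is an identity of
  -- integers, which this homomorphism carries back to ℚ.
  fromℚᵘ-homo-+ : ∀ p q → fromℚᵘ (p ℚᵘ.+ q) ≡ fromℚᵘ p + fromℚᵘ q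
  fromℚᵘ-homo-+ p q = toℚᵘ-injective (ℚᵘ.≃-trans (toℚᵘ-fromℚᵘ (p ℚᵘ.+ q))
    (ℚᵘ.≃-sym (ℚᵘ.≃-trans (toℚᵘ-homo-+ (fromℚᵘ p) (fromℚᵘ q)) (ℚᵘ.+-cong (toℚᵘ-fromℚᵘ p) (toℚᵘ-fromℚᵘ q)))))

  fromℚᵘ-homo-* : ∀ p q → fromℚᵘ (p ℚᵘ.* q) ≡ fromℚᵘ p * fromℚᵘ q
  fromℚᵘ-homo-* p q = toℚᵘ-injective (ℚᵘ.≃-trans (toℚᵘ-fromℚᵘ (p ℚᵘ.* q))
    (ℚᵘ.≃-sym (ℚᵘ.≃-trans (toℚᵘ-homo-* (fromℚᵘ p) (fromℚᵘ q)) (ℚᵘ.*-cong (toℚᵘ-fromℚᵘ p) (toℚᵘ-fromℚᵘ q)))))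

  fromℕQ-+ : ∀ m n → fromℕQ (m ℕ.+ n) ≡ fromℕQ m + fromℕQ n
  fromℕQ-+ m n = trans (fromℚᵘ-cong {mkℚᵘ (+ (m ℕ.+ n)) 0} {mkℚᵘ (+ m) 0 ℚᵘ.+ mkℚᵘ (+ n) 0}
      (*≡* (cong (ℤ._* + 1) (sym (cong₂ ℤ._+_ (ℤ.*-identityʳ (+ m)) (ℤ.*-identityʳ (+ n)))))))
    (fromℚᵘ-homo-+ (mkℚᵘ (+ m) 0) (mkℚᵘ (+ n) 0))

  fromℕQ-* : ∀ m n → fromℕQ (m ℕ.* n) ≡ fromℕQ m * fromℕQ n
  fromℕQ-* m n = trans (fromℚᵘ-cong {mkℚᵘ (+ (m ℕ.* n)) 0} {mkℚᵘ (+ m) 0 ℚᵘ.* mkℚᵘ (+ n) 0}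
      (*≡* (cong (ℤ._* + 1) (ℤ.pos-* m n))))
    (fromℚᵘ-homo-* (mkℚᵘ (+ m) 0) (mkℚᵘ (+ n) 0))

  fromℕQ-suc : ∀ n → fromℕQ (suc n) ≡ 1ℚ + fromℕQ n
  fromℕQ-suc n = fromℕQ-+ 1 n

  1/n*n≡1 : ∀ n .{{_ : ℕ.NonZero n}} → ((+ 1) / n) * fromℕQ n ≡ 1ℚ
  1/n*n≡1 (suc n) = trans (sym (fromℚᵘ-homo-* (mkℚᵘ (+ 1) n) (mkℚᵘ (+ (suc n)) 0)))
    (fromℚᵘ-cong {mkℚᵘ (+ 1) n ℚᵘ.* mkℚᵘ (+ (suc n)) 0} {mkℚᵘ (+ 1) 0}
      (*≡* (trans (ℤ.*-identityʳ _) (trans (ℤ.*-identityˡ (+ suc n))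
        (sym (trans (ℤ.*-identityˡ _) (cong +_ (ℕ.*-identityʳ (suc n)))))))))

  open SemiringSolver (CommutativeRing.commutativeSemiring +-*-commutativeRing)
    using (solve; _:+_; _:*_; _:=_)

  fromℕQ-cancelˡ : ∀ n .{{_ : ℕ.NonZero n}} {p q} → fromℕQ n * p ≡ fromℕQ n * q → p ≡ q
  fromℕQ-cancelˡ n {p} {q} eq = begin
    p                              ≡⟨ cancel p ⟨
    (+ 1) / n * (fromℕQ n * p)     ≡⟨ cong ((+ 1) / n *_) eq ⟩
    (+ 1) / n * (fromℕQ n * q)     ≡⟨ cancel q ⟩
    q                              ∎
    where
    open ≡-Reasoning
    cancel : ∀ r → (+ 1) / n * (fromℕQ n * r) ≡ r
    cancel r = trans (sym (*-assoc ((+ 1) / n) (fromℕQ n) r)) (trans (cong (_* r) (1/n*n≡1 n)) (*-identityˡ r))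

  invFact*n!≡1 : ∀ n → invFact n * fromℕQ (n !) ≡ 1ℚ
  invFact*n!≡1 n = 1/n*n≡1 (n !) {{n ℕ.!≢0}}

  invFact-suc : ∀ n → fromℕQ (suc n) * invFact (suc n) ≡ invFact n
  invFact-suc n = fromℕQ-cancelˡ (n !) {{n ℕ.!≢0}} (begin
    fromℕQ (n !) * (fromℕQ (suc n) * invFact (suc n)) ≡⟨ solve 3 (λ a b c → a :* (b :* c) := c :* (b :* a)) refl
                                                           (fromℕQ (n !)) (fromℕQ (suc n)) (invFact (suc n)) ⟩
    invFact (suc n) * (fromℕQ (suc n) * fromℕQ (n !)) ≡⟨ cong (invFact (suc n) *_) (fromℕQ-* (suc n) (n !)) ⟨
    invFact (suc n) * fromℕQ (suc n !)                ≡⟨ invFact*n!≡1 (suc n) ⟩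
    1ℚ                                                ≡⟨ invFact*n!≡1 n ⟨
    invFact n * fromℕQ (n !)                          ≡⟨ *-comm (invFact n) _ ⟩
    fromℕQ (n !) * invFact n                          ∎)
    where open ≡-Reasoning

  module Q = PowerSeries +-*-commutativeRing
  open Q using (Series; _≋_; _⊛_; _⊕_; tail; X) public
  module S = CommutativeRing Q.seriesRing
  open SemiringSolver S.commutativeSemiring
    using () renaming (solve to solveˢ; _:+_ to _⊞_; _:*_ to _⊠_; _:=_ to _≐_)

  -- The Euler operator x d/dx, which unlike d/dx involves no index shift.
  θ : Series → Series
  θ f n = fromℕQ n * f n

  suc*≡+ : ∀ n p → fromℕQ (suc n) * p ≡ p + fromℕQ n * p
  suc*≡+ n p = begin
    fromℕQ (suc n) * p     ≡⟨ cong (_* p) (fromℕQ-suc n) ⟩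
    (1ℚ + fromℕQ n) * p    ≡⟨ *-distribʳ-+ p 1ℚ (fromℕQ n) ⟩
    1ℚ * p + fromℕQ n * p  ≡⟨ cong (_+ fromℕQ n * p) (*-identityˡ p) ⟩
    p + fromℕQ n * p       ∎
    where open ≡-Reasoning

  θ-⊛ : ∀ f g → θ (f ⊛ g) ≋ θ f ⊛ g ⊕ f ⊛ θ g
  θ-⊛ f g zero    = begin
    fromℕQ 0 * (f 0 * g 0)                        ≡⟨ *-zeroˡ (f 0 * g 0) ⟩
    0ℚ                                            ≡⟨ cong₂ _+_ (*-zeroˡ (g 0)) (*-zeroʳ (f 0)) ⟨
    0ℚ * g 0 + f 0 * 0ℚ                           ≡⟨ cong₂ (λ a b → a * g 0 + f 0 * b) (*-zeroˡ (f 0)) (*-zeroˡ (g 0)) ⟨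
    fromℕQ 0 * f 0 * g 0 + f 0 * (fromℕQ 0 * g 0) ∎
    where open ≡-Reasoning
  θ-⊛ f g (suc n) = begin
    ι′ * (f 0 * g (suc n) + (tail f ⊛ g) n)
      ≡⟨ *-distribˡ-+ ι′ (f 0 * g (suc n)) ((tail f ⊛ g) n) ⟩
    ι′ * (f 0 * g (suc n)) + ι′ * (tail f ⊛ g) n
      -- The weight n + 1 splits as 1 plus n: the part n belongs to the induction hypothesis for
      -- `tail f`, and the extra 1 is absorbed because `tail (θ f)` agrees with
      -- `tail f ⊕ θ (tail f)`.
      ≡⟨ cong (λ a → ι′ * (f 0 * g (suc n)) + a) (suc*≡+ n ((tail f ⊛ g) n)) ⟩
    ι′ * (f 0 * g (suc n)) + ((tail f ⊛ g) n + θ (tail f ⊛ g) n)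
      ≡⟨ cong (λ a → ι′ * (f 0 * g (suc n)) + ((tail f ⊛ g) n + a)) (θ-⊛ (tail f) g n) ⟩
    ι′ * (f 0 * g (suc n)) + ((tail f ⊛ g) n + ((θ (tail f) ⊛ g) n + (tail f ⊛ θ g) n))
      ≡⟨ solve 6 (λ i a b c d e → i :* (a :* b) :+ (c :+ (d :+ e)) := c :+ d :+ (a :* (i :* b) :+ e))
           refl ι′ (f 0) (g (suc n)) ((tail f ⊛ g) n) ((θ (tail f) ⊛ g) n) ((tail f ⊛ θ g) n) ⟩
    (tail f ⊛ g) n + (θ (tail f) ⊛ g) n + (f ⊛ θ g) (suc n)
      ≡⟨ cong (_+ (f ⊛ θ g) (suc n)) (Q.⊛-distribʳ g (tail f) (θ (tail f)) n) ⟨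
    ((tail f ⊕ θ (tail f)) ⊛ g) n + (f ⊛ θ g) (suc n)
      ≡⟨ cong (_+ (f ⊛ θ g) (suc n)) (Q.⊛-cong {g = g} (λ k → sym (suc*≡+ k (f (suc k)))) (λ _ → refl) n) ⟩
    (tail (θ f) ⊛ g) n + (f ⊛ θ g) (suc n)
      ≡⟨ cong (_+ (f ⊛ θ g) (suc n)) (+-identityˡ ((tail (θ f) ⊛ g) n)) ⟨
    0ℚ + (tail (θ f) ⊛ g) n + (f ⊛ θ g) (suc n)
      ≡⟨ cong (λ a → a + (tail (θ f) ⊛ g) n + (f ⊛ θ g) (suc n)) (*-zeroˡ (g (suc n))) ⟨
    0ℚ * g (suc n) + (tail (θ f) ⊛ g) n + (f ⊛ θ g) (suc n)
      ≡⟨ cong (λ a → a * g (suc n) + (tail (θ f) ⊛ g) n + (f ⊛ θ g) (suc n)) (*-zeroˡ (f 0)) ⟨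
    (θ f ⊛ g) (suc n) + (f ⊛ θ g) (suc n) ∎
    where
    open ≡-Reasoning
    ι′ = fromℕQ (suc n)

  -- Positive weights can be cancelled over ℚ. Only the constant term is lost under θ, hence the
  -- separate hypothesis at 0.
  θ-determines : ∀ f g → f 0 ≡ g 0 → (∀ n → θ f (suc n) ≡ θ g (suc n)) → f ≋ g
  θ-determines f g p q zero    = p
  θ-determines f g p q (suc n) = fromℕQ-cancelˡ (suc n) (q n)

  expS₁ : Series
  expS₁ = invFact

  θ-exp : θ expS₁ ≋ X ⊛ expS₁
  θ-exp zero    = trans (*-zeroˡ (invFact 0)) (sym (Q.X-⊛-zero expS₁))
  θ-exp (suc n) = trans (invFact-suc n) (sym (Q.X-⊛-suc expS₁ n))

  -- The series of exp(-x), given by the recurrence that its Euler equation dictates.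
  exp⁻¹ : Series
  exp⁻¹ zero    = 1ℚ
  exp⁻¹ (suc n) = - (exp⁻¹ n * ((+ 1) / suc n))

  cancel-1/suc : ∀ n p → fromℕQ (suc n) * (p * ((+ 1) / suc n)) ≡ p
  cancel-1/suc n p = begin
    fromℕQ (suc n) * (p * r) ≡⟨ solve 3 (λ a b c → a :* (b :* c) := b :* (c :* a)) refl (fromℕQ (suc n)) p r ⟩
    p * (r * fromℕQ (suc n)) ≡⟨ cong (p *_) (1/n*n≡1 (suc n)) ⟩
    p * 1ℚ                   ≡⟨ *-identityʳ p ⟩
    p                        ∎
    where
    open ≡-Reasoning
    r = (+ 1) / suc n

  θ-exp⁻¹ : θ exp⁻¹ ≋ S.- (X ⊛ exp⁻¹)
  θ-exp⁻¹ zero    = trans (*-zeroˡ 1ℚ) (cong -_ (sym (Q.X-⊛-zero exp⁻¹)))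
  θ-exp⁻¹ (suc n) = begin
    fromℕQ (suc n) * - p    ≡⟨ neg-distribʳ-* (fromℕQ (suc n)) p ⟨
    - (fromℕQ (suc n) * p)  ≡⟨ cong -_ (cancel-1/suc n (exp⁻¹ n)) ⟩
    - exp⁻¹ n               ≡⟨ cong -_ (Q.X-⊛-suc exp⁻¹ n) ⟨
    - (X ⊛ exp⁻¹) (suc n)   ∎
    where
    open ≡-Reasoning
    p = exp⁻¹ n * ((+ 1) / suc n)

  module _ where
    open RingProperties S.ring using (-‿distribʳ-*)
    open SetoidReasoning S.setoid

    θ[exp*exp⁻¹]≋0 : θ (expS₁ ⊛ exp⁻¹) ≋ S.0#
    θ[exp*exp⁻¹]≋0 = begin
      θ (expS₁ ⊛ exp⁻¹)
        ≈⟨ θ-⊛ expS₁ exp⁻¹ ⟩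
      θ expS₁ ⊛ exp⁻¹ ⊕ expS₁ ⊛ θ exp⁻¹
        ≈⟨ S.+-cong (S.*-congʳ θ-exp) (S.*-congˡ {expS₁} θ-exp⁻¹) ⟩
      X ⊛ expS₁ ⊛ exp⁻¹ ⊕ expS₁ ⊛ (S.- (X ⊛ exp⁻¹))
        ≈⟨ S.+-congˡ {X ⊛ expS₁ ⊛ exp⁻¹} (S.sym (-‿distribʳ-* expS₁ (X ⊛ exp⁻¹))) ⟩
      X ⊛ expS₁ ⊛ exp⁻¹ ⊕ S.- (expS₁ ⊛ (X ⊛ exp⁻¹))
        ≈⟨ S.+-congʳ {S.- (expS₁ ⊛ (X ⊛ exp⁻¹))} (solveˢ 3 (λ x a b → x ⊠ a ⊠ b ≐ a ⊠ (x ⊠ b)) S.refl X expS₁ exp⁻¹) ⟩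
      expS₁ ⊛ (X ⊛ exp⁻¹) ⊕ S.- (expS₁ ⊛ (X ⊛ exp⁻¹))
        ≈⟨ S.-‿inverseʳ (expS₁ ⊛ (X ⊛ exp⁻¹)) ⟩
      S.0# ∎

  exp*exp⁻¹≋1 : expS₁ ⊛ exp⁻¹ ≋ S.1#
  exp*exp⁻¹≋1 = θ-determines (expS₁ ⊛ exp⁻¹) S.1# refl
    (λ n → trans (θ[exp*exp⁻¹]≋0 (suc n)) (sym (*-zeroʳ (fromℕQ (suc n)))))

  -- (1 - 2x)^{-1/2} = Σ (1·3·⋯·(2n-1)) xⁿ / n!
  rsqrt : Series
  rsqrt zero    = 1ℚ
  rsqrt (suc n) = fromℕQ (suc (n ℕ.+ n)) * rsqrt n * ((+ 1) / suc n)

  -- This is (1 - 2x) t' = t, multiplied by x and with the negative term moved to the other side, so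
  -- that a semiring solver can handle it.
  θ-rsqrt : θ rsqrt ≋ X ⊛ (θ rsqrt ⊕ θ rsqrt ⊕ rsqrt)
  θ-rsqrt zero    = trans (*-zeroˡ 1ℚ) (sym (Q.X-⊛-zero (θ rsqrt ⊕ θ rsqrt ⊕ rsqrt)))
  θ-rsqrt (suc n) = begin
    θ rsqrt (suc n)                           ≡⟨ cancel-1/suc n (fromℕQ (suc (n ℕ.+ n)) * rsqrt n) ⟩
    fromℕQ (suc (n ℕ.+ n)) * rsqrt n          ≡⟨ suc*≡+ (n ℕ.+ n) (rsqrt n) ⟩
    rsqrt n + fromℕQ (n ℕ.+ n) * rsqrt n      ≡⟨ +-comm (rsqrt n) _ ⟩
    fromℕQ (n ℕ.+ n) * rsqrt n + rsqrt n      ≡⟨ cong (λ a → a * rsqrt n + rsqrt n) (fromℕQ-+ n n) ⟩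
    (fromℕQ n + fromℕQ n) * rsqrt n + rsqrt n ≡⟨ cong (_+ rsqrt n) (*-distribʳ-+ (rsqrt n) (fromℕQ n) (fromℕQ n)) ⟩
    θ rsqrt n + θ rsqrt n + rsqrt n           ≡⟨ Q.X-⊛-suc (θ rsqrt ⊕ θ rsqrt ⊕ rsqrt) n ⟨
    (X ⊛ (θ rsqrt ⊕ θ rsqrt ⊕ rsqrt)) (suc n) ∎
    where open ≡-Reasoning

  rsqrt² : Series
  rsqrt² = rsqrt ⊛ rsqrt

  -- The Leibniz rule turns the equation of t into an equation for t² that 1 / (1 - 2x) satisfies
  -- too. This identifies t² without the convolution identity for central binomial coefficients.
  θ-rsqrt² : θ rsqrt² ≋ X ⊛ (θ rsqrt² ⊕ θ rsqrt² ⊕ (rsqrt² ⊕ rsqrt²))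
  θ-rsqrt² = begin
    θ (t ⊛ t)                                     ≈⟨ θ-⊛ t t ⟩
    θ t ⊛ t ⊕ t ⊛ θ t                             ≈⟨ S.+-cong (S.*-congʳ θ-rsqrt) (S.*-congˡ {t} θ-rsqrt) ⟩
    X ⊛ (θ t ⊕ θ t ⊕ t) ⊛ t ⊕ t ⊛ (X ⊛ (θ t ⊕ θ t ⊕ t))
      ≈⟨ solveˢ 3 (λ x d t →
            x ⊠ (d ⊞ d ⊞ t) ⊠ t ⊞ t ⊠ (x ⊠ (d ⊞ d ⊞ t))
            ≐ x ⊠ ((d ⊠ t ⊞ t ⊠ d) ⊞ (d ⊠ t ⊞ t ⊠ d) ⊞ (t ⊠ t ⊞ t ⊠ t)))
          S.refl X (θ t) t ⟩
    X ⊛ ((θ t ⊛ t ⊕ t ⊛ θ t) ⊕ (θ t ⊛ t ⊕ t ⊛ θ t) ⊕ (t ⊛ t ⊕ t ⊛ t))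
      ≈⟨ S.*-congˡ {X} (S.+-congʳ {t ⊛ t ⊕ t ⊛ t} (S.+-cong (S.sym (θ-⊛ t t)) (S.sym (θ-⊛ t t)))) ⟩
    X ⊛ (θ rsqrt² ⊕ θ rsqrt² ⊕ (rsqrt² ⊕ rsqrt²)) ∎
    where
    open SetoidReasoning S.setoid
    t = rsqrt

  rsqrt²-suc : ∀ n → rsqrt² (suc n) ≡ rsqrt² n + rsqrt² n
  rsqrt²-suc n = fromℕQ-cancelˡ (suc n) (begin
    θ rsqrt² (suc n)                ≡⟨ θ-rsqrt² (suc n) ⟩
    (X ⊛ (θ rsqrt² ⊕ θ rsqrt² ⊕ (rsqrt² ⊕ rsqrt²))) (suc n) ≡⟨ Q.X-⊛-suc (θ rsqrt² ⊕ θ rsqrt² ⊕ (rsqrt² ⊕ rsqrt²)) n ⟩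
    i * y + i * y + (y + y)         ≡⟨ solve 2 (λ z y → z :+ z :+ (y :+ y) := y :+ z :+ (y :+ z)) refl (i * y) y ⟩
    y + i * y + (y + i * y)         ≡⟨ cong₂ _+_ (suc*≡+ n y) (suc*≡+ n y) ⟨
    i′ * y + i′ * y                 ≡⟨ *-distribˡ-+ i′ y y ⟨
    i′ * (y + y)                    ∎)
    where
    open ≡-Reasoning
    i = fromℕQ n
    i′ = fromℕQ (suc n)
    y = rsqrt² n

  1-2X : Series
  1-2X = S.1# S.+ (S.- (X ⊕ X))

  -- Stated for any `f` because both `rsqrt²` and `powersOfTwo` are recognised as 1 / (1 - 2x)
  -- through it.
  1-2X-inverse : ∀ f → f 0 ≡ 1ℚ → (∀ n → f (suc n) ≡ f n + f n) → 1-2X ⊛ f ≋ S.1#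
  1-2X-inverse f f0 f-suc n = trans (expand n) (coefficients n)
    where
    open RingProperties S.ring using (-‿distribˡ-*)
    expand : 1-2X ⊛ f ≋ f ⊕ S.- (X ⊛ f ⊕ X ⊛ f)
    expand = begin
      1-2X ⊛ f                           ≈⟨ S.distribʳ f S.1# (S.- (X ⊕ X)) ⟩
      S.1# ⊛ f ⊕ (S.- (X ⊕ X)) ⊛ f       ≈⟨ S.+-cong (S.*-identityˡ f) (S.sym (-‿distribˡ-* (X ⊕ X) f)) ⟩
      f ⊕ S.- ((X ⊕ X) ⊛ f)              ≈⟨ S.+-congˡ {f} (S.-‿cong (S.distribʳ f X X)) ⟩
      f ⊕ S.- (X ⊛ f ⊕ X ⊛ f)            ∎
      where open SetoidReasoning S.setoid
    coefficients : ∀ n → f n - ((X ⊛ f) n + (X ⊛ f) n) ≡ S.1# n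
    coefficients zero    = cong₂ _-_ f0 (cong₂ _+_ (Q.X-⊛-zero f) (Q.X-⊛-zero f))
    coefficients (suc n) = trans
      (cong₂ _-_ (f-suc n) (cong₂ _+_ (Q.X-⊛-suc f n) (Q.X-⊛-suc f n)))
      (+-inverseʳ (f n + f n))

  -- Defined from `rsqrt` rather than by a binomial series: its square and its inverse then both
  -- follow from what is known about `rsqrt²`.
  sqrt : Series
  sqrt = 1-2X ⊛ rsqrt

  sqrt*rsqrt≋1 : sqrt ⊛ rsqrt ≋ S.1#
  sqrt*rsqrt≋1 = S.trans (S.*-assoc 1-2X rsqrt rsqrt) (1-2X-inverse rsqrt² refl rsqrt²-suc)

  sqrt*sqrt≋1-2X : sqrt ⊛ sqrt ≋ 1-2X
  sqrt*sqrt≋1-2X = begin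
    sqrt ⊛ (1-2X ⊛ rsqrt)   ≈⟨ solveˢ 3 (λ s p t → s ⊠ (p ⊠ t) ≐ p ⊠ (s ⊠ t)) S.refl sqrt 1-2X rsqrt ⟩
    1-2X ⊛ (sqrt ⊛ rsqrt)   ≈⟨ S.*-congˡ {1-2X} sqrt*rsqrt≋1 ⟩
    1-2X ⊛ S.1#             ≈⟨ S.*-identityʳ 1-2X ⟩
    1-2X                    ∎
    where
    open SetoidReasoning S.setoid

  -- n! [xⁿ] of this series counts the perfect matchings of 2n points that share
  -- no edge with a given one.
  derangements : Series
  derangements = rsqrt ⊛ exp⁻¹

  derangements*exp≋rsqrt : derangements ⊛ expS₁ ≋ rsqrt
  derangements*exp≋rsqrt = begin
    rsqrt ⊛ exp⁻¹ ⊛ expS₁   ≈⟨ S.*-assoc rsqrt exp⁻¹ expS₁ ⟩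
    rsqrt ⊛ (exp⁻¹ ⊛ expS₁) ≈⟨ S.*-congˡ {rsqrt} (S.trans (S.*-comm exp⁻¹ expS₁) exp*exp⁻¹≋1) ⟩
    rsqrt ⊛ S.1#            ≈⟨ S.*-identityʳ rsqrt ⟩
    rsqrt                   ∎
    where open SetoidReasoning S.setoid

  derangements*sqrt*exp≋1 : derangements ⊛ (sqrt ⊛ expS₁) ≋ S.1#
  derangements*sqrt*exp≋1 = begin
    d ⊛ (sqrt ⊛ expS₁)     ≈⟨ solveˢ 3 (λ d s e → d ⊠ (s ⊠ e) ≐ s ⊠ (d ⊠ e)) S.refl d sqrt expS₁ ⟩
    sqrt ⊛ (d ⊛ expS₁)     ≈⟨ S.*-congˡ {sqrt} derangements*exp≋rsqrt ⟩
    sqrt ⊛ rsqrt           ≈⟨ sqrt*rsqrt≋1 ⟩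
    S.1#                   ∎
    where
    open SetoidReasoning S.setoid
    d = derangements

-- Series in z and u as power series in u over ℚ[[z]], and the substitution.

module BivariateSeries where

  open import Function using (flip)
  open import Data.Nat as ℕ using (ℕ; zero; suc; _∸_; s≤s)
  import Data.Nat.Properties as ℕ
  open import Data.Nat.Combinatorics using (_C_; nCk+nC[k+1]≡[n+1]C[k+1])
  open import Data.Integer using (+_)
  open import Data.Rational using (ℚ; 0ℚ; 1ℚ; _+_; _*_; _-_; -_; _/_)
  open import Data.Rational.Properties
  open import Algebra.Bundles using (CommutativeRing)
  import Algebra.Properties.Semiring.Exp as SemiringExponentiation
  import Algebra.Solver.Ring.NaturalCoefficients.Default as SemiringSolver
  import Relation.Binary.Reasoning.Setoid as SetoidReasoning
  open import Relation.Binary.PropositionalEquality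
  open import Relation.Nullary using (yes; no; contradiction)
  open PowerSeriesRings
  open RationalSeries

  module B = PowerSeries Q.seriesRing
  module T = CommutativeRing B.seriesRing
  open ConstantCoefficients +-*-commutativeRing using (constᶜ; constᶜ-⊛)
  open SemiringExponentiation S.semiring using () renaming (_^_ to _^ˢ_)
  open SemiringExponentiation T.semiring using () renaming (_^_ to _^ᵗ_; ^-congˡ to ^ᵗ-congˡ)
  open SemiringSolver T.commutativeSemiring
    using () renaming (solve to solveᵗ; _:+_ to _⊞_; _:*_ to _⊠_; _:=_ to _≐_)
  open SemiringSolver (CommutativeRing.commutativeSemiring +-*-commutativeRing)
    using (solve; _:+_; _:*_; _:=_)

  sumQ-cong : ∀ n {f g} → (∀ k → k ℕ.≤ n → f k ≡ g k) → sumQ n f ≡ sumQ n g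
  sumQ-cong zero    p = p 0 ℕ.≤-refl
  sumQ-cong (suc n) p = cong₂ _+_ (sumQ-cong n (λ k k≤n → p k (ℕ.m≤n⇒m≤1+n k≤n))) (p (suc n) ℕ.≤-refl)

  sumQ-zero : ∀ n {f} → (∀ k → k ℕ.≤ n → f k ≡ 0ℚ) → sumQ n f ≡ 0ℚ
  sumQ-zero zero    p = p 0 ℕ.≤-refl
  sumQ-zero (suc n) p = cong₂ _+_ (sumQ-zero n (λ k k≤n → p k (ℕ.m≤n⇒m≤1+n k≤n))) (p (suc n) ℕ.≤-refl)

  sumQ-+ : ∀ n f g → sumQ n (λ k → f k + g k) ≡ sumQ n f + sumQ n g
  sumQ-+ zero    f g = refl
  sumQ-+ (suc n) f g = trans (cong (_+ (f (suc n) + g (suc n))) (sumQ-+ n f g))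
    (solve 4 (λ a b c d → a :+ b :+ (c :+ d) := a :+ c :+ (b :+ d)) refl
      (sumQ n f) (sumQ n g) (f (suc n)) (g (suc n)))

  sumQ-swap : ∀ m n (f : ℕ → ℕ → ℚ) →
    sumQ m (λ a → sumQ n (λ b → f a b)) ≡ sumQ n (λ b → sumQ m (λ a → f a b))
  sumQ-swap zero    n f = refl
  sumQ-swap (suc m) n f = trans (cong (_+ sumQ n (f (suc m))) (sumQ-swap m n f))
    (sym (sumQ-+ n (λ b → sumQ m (λ a → f a b)) (f (suc m))))

  sumQ-single : ∀ n k f → k ℕ.≤ n → (∀ i → i ≢ k → f i ≡ 0ℚ) → sumQ n f ≡ f k
  sumQ-single n k f k≤n p with n ℕ.≟ k
  sumQ-single zero    k f k≤n p | yes refl = refl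
  sumQ-single (suc n) k f k≤n p | yes refl =
    trans (cong (_+ f (suc n)) (sumQ-zero n (λ i i≤n → p i (ℕ.<⇒≢ (s≤s i≤n))))) (+-identityˡ _)
  sumQ-single zero    k f k≤n p | no n≢k = contradiction (sym (ℕ.n≤0⇒n≡0 k≤n)) n≢k
  sumQ-single (suc n) k f k≤n p | no n≢k =
    trans (cong₂ _+_ (sumQ-single n k f (ℕ.<⇒≤pred (ℕ.≤∧≢⇒< k≤n (≢-sym n≢k))) p) (p (suc n) n≢k))
      (+-identityʳ (f k))

  sum≤≡sumQ : ∀ n f → Q.sum≤ n f ≡ sumQ n f
  sum≤≡sumQ zero    f = refl
  sum≤≡sumQ (suc n) f = cong (_+ f (suc n)) (sum≤≡sumQ n f)

  sum≤-pointwise : ∀ n (f : ℕ → Series) m → B.sum≤ n f m ≡ sumQ n (λ k → f k m)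
  sum≤-pointwise zero    f m = refl
  sum≤-pointwise (suc n) f m = cong (_+ f (suc n) m) (sum≤-pointwise n f m)

  -- flip turns a series in z and u into a series in u over ℚ[[z]].
  flip-*S : ∀ F G → flip (F *S G) B.≋ flip F B.⊛ flip G
  flip-*S F G j m = begin
    sumQ m (λ a → sumQ j (λ b → F a b * G (m ∸ a) (j ∸ b)))
      ≡⟨ sumQ-swap m j (λ a b → F a b * G (m ∸ a) (j ∸ b)) ⟩
    sumQ j (λ b → sumQ m (λ a → F a b * G (m ∸ a) (j ∸ b)))
      ≡⟨ sumQ-cong j (λ b _ → trans (sym (sum≤≡sumQ m _))
           (sym (Q.⊛-coefficient (flip F b) (flip G (j ∸ b)) m))) ⟩
    sumQ j (λ b → (flip F b ⊛ flip G (j ∸ b)) m)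
      ≡⟨ sum≤-pointwise j (λ b → flip F b ⊛ flip G (j ∸ b)) m ⟨
    B.sum≤ j (λ b → flip F b ⊛ flip G (j ∸ b)) m
      ≡⟨ B.⊛-coefficient (flip F) (flip G) j m ⟨
    (flip F B.⊛ flip G) j m ∎
    where open ≡-Reasoning

  flip-oneS : flip oneS B.≋ T.1#
  flip-oneS zero    zero    = refl
  flip-oneS zero    (suc m) = refl
  flip-oneS (suc j) zero    = refl
  flip-oneS (suc j) (suc m) = refl

  flip-powS : ∀ F n → flip (powS F n) B.≋ flip F ^ᵗ n
  flip-powS F zero    = flip-oneS
  flip-powS F (suc n) = T.trans (flip-*S (powS F n) F)
    (T.trans (T.*-congʳ {flip F} (flip-powS F n)) (T.*-comm (flip F ^ᵗ n) (flip F)))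

  flip-zS : flip zS B.≋ B.constS X
  flip-zS zero    zero          = refl
  flip-zS zero    (suc zero)    = refl
  flip-zS zero    (suc (suc m)) = refl
  flip-zS (suc j) zero          = refl
  flip-zS (suc j) (suc zero)    = refl
  flip-zS (suc j) (suc (suc m)) = refl

  flip-uS : flip uS B.≋ B.X
  flip-uS zero          zero    = refl
  flip-uS zero          (suc m) = refl
  flip-uS (suc zero)    zero    = refl
  flip-uS (suc zero)    (suc m) = refl
  flip-uS (suc (suc j)) zero    = refl
  flip-uS (suc (suc j)) (suc m) = refl

  two*≡+ : ∀ p → two * p ≡ p + p
  two*≡+ p = trans (*-distribʳ-+ p 1ℚ 1ℚ) (cong₂ _+_ (*-identityˡ p) (*-identityˡ p))

  constS-^ : ∀ f n → B.constS f ^ᵗ n B.≋ B.constS (f ^ˢ n)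
  constS-^ f zero    = T.refl
  constS-^ f (suc n) = T.trans (T.*-congˡ {B.constS f} (constS-^ f n)) (T.sym (B.constS-* f (f ^ˢ n)))

  constS-cong : ∀ {f g} → f ≋ g → B.constS f B.≋ B.constS g
  constS-cong p zero    = p
  constS-cong p (suc n) = λ _ → refl

  -- 1 / (1 - 2z)
  powersOfTwo : Series
  powersOfTwo zero    = 1ℚ
  powersOfTwo (suc n) = powersOfTwo n + powersOfTwo n

  powersOfTwo-inverse : 1-2X ⊛ powersOfTwo ≋ S.1#
  powersOfTwo-inverse = 1-2X-inverse powersOfTwo refl (λ _ → refl)

  two^n≡powersOfTwo : ∀ n → SemiringExponentiation._^_ (CommutativeRing.semiring +-*-commutativeRing) two n
                            ≡ powersOfTwo n
  two^n≡powersOfTwo zero    = refl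
  two^n≡powersOfTwo (suc n) = trans (cong (two *_) (two^n≡powersOfTwo n)) (two*≡+ (powersOfTwo n))

  flip-2zS : flip (two ·S zS) B.≋ B.constS (Q.monomial two)
  flip-2zS zero    m = cong (two *_) (flip-zS zero m)
  flip-2zS (suc j) m = trans (cong (two *_) (flip-zS (suc j) m)) (*-zeroʳ two)

  flip-pow-2zS : ∀ n → flip (powS (two ·S zS) n) B.≋ B.constS (Q.monomial two ^ˢ n)
  flip-pow-2zS n = T.trans (flip-powS (two ·S zS) n)
    (T.trans (^ᵗ-congˡ n flip-2zS) (constS-^ (Q.monomial two) n))

  -- In the geometric sum only n = m contributes to z^m, and the truncation at m + j keeps that
  -- term.
  flip-inv1-2z : flip inv1-2z B.≋ B.constS powersOfTwo
  flip-inv1-2z zero    m = begin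
    sumQ (m ℕ.+ 0) (λ n → powS (two ·S zS) n m 0)   ≡⟨ sumQ-cong (m ℕ.+ 0) (λ n _ → flip-pow-2zS n 0 m) ⟩
    sumQ (m ℕ.+ 0) (λ n → (Q.monomial two ^ˢ n) m)
      ≡⟨ sumQ-single (m ℕ.+ 0) m _ (ℕ.m≤m+n m 0) (λ n → Q.monomial-^-offDiagonal two n m) ⟩
    (Q.monomial two ^ˢ m) m                         ≡⟨ Q.monomial-^-diagonal two m ⟩
    _                                               ≡⟨ two^n≡powersOfTwo m ⟩
    powersOfTwo m                                   ∎
    where open ≡-Reasoning
  flip-inv1-2z (suc j) m = sumQ-zero (m ℕ.+ suc j) (λ n _ → flip-pow-2zS n (suc j) m)

  -- 2z / (1 - 2z)
  Y : Series
  Y n = two * (X ⊛ powersOfTwo) n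

  2zu/1-2z : PS
  2zu/1-2z = two ·S (zS *S uS *S inv1-2z)

  flip-2zu/1-2z : flip 2zu/1-2z B.≋ B.monomial Y
  flip-2zu/1-2z j m = begin
    two * (zS *S uS *S inv1-2z) m j                       ≡⟨ cong (two *_) (product j m) ⟩
    two * ((X ⊛ powersOfTwo) ⊛ B.X j) m                   ≡⟨ Q.⊛-scaleˡ two (X ⊛ powersOfTwo) (B.X j) m ⟨
    B.monomial Y j m                                      ∎
    where
    product : flip (zS *S uS *S inv1-2z) B.≋ (λ j → (X ⊛ powersOfTwo) ⊛ B.X j)
    product = begin
      flip (zS *S uS *S inv1-2z)                          ≈⟨ flip-*S (zS *S uS) inv1-2z ⟩
      flip (zS *S uS) B.⊛ flip inv1-2z                    ≈⟨ T.*-cong (T.trans (flip-*S zS uS) (T.*-cong flip-zS flip-uS)) flip-inv1-2z ⟩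
      B.constS X B.⊛ B.X B.⊛ B.constS powersOfTwo         ≈⟨ solveᵗ 3 (λ a b c → a ⊠ b ⊠ c ≐ a ⊠ c ⊠ b) T.refl (B.constS X) B.X (B.constS powersOfTwo) ⟩
      B.constS X B.⊛ B.constS powersOfTwo B.⊛ B.X         ≈⟨ T.*-congʳ {B.X} (T.sym (B.constS-* X powersOfTwo)) ⟩
      B.constS (X ⊛ powersOfTwo) B.⊛ B.X                  ≈⟨ B.constS-⊛ (X ⊛ powersOfTwo) B.X ⟩
      (λ j → (X ⊛ powersOfTwo) ⊛ B.X j)                   ∎
      where open SetoidReasoning T.setoid
    open ≡-Reasoning

  flip-pow-2zu/1-2z : ∀ n → flip (powS 2zu/1-2z n) B.≋ B.monomial Y ^ᵗ n
  flip-pow-2zu/1-2z n = T.trans (flip-powS 2zu/1-2z n) (^ᵗ-congˡ n flip-2zu/1-2z)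

  -- The substitution f(x) ↦ f(2zu / (1 - 2z)).
  subs : Series → B.Series
  subs f = B.rescale Y (constᶜ f)

  subs-coefficient : ∀ f j m → subs f j m ≡ f j * (Y ^ˢ j) m
  subs-coefficient f j m = Q.constS-⊛ (f j) (Y ^ˢ j) m

  subs-cong : ∀ {f g} → f ≋ g → subs f B.≋ subs g
  subs-cong {f} {g} p j m = trans (subs-coefficient f j m)
    (trans (cong (_* (Y ^ˢ j) m) (p j)) (sym (subs-coefficient g j m)))

  subs-⊛ : ∀ f g → subs f B.⊛ subs g B.≋ subs (f ⊛ g)
  subs-⊛ f g = T.trans (B.rescale-⊛ Y (constᶜ f) (constᶜ g))
    (λ j → S.*-congʳ {Y ^ˢ j} (S.sym (constᶜ-⊛ f g j)))

  subs-1 : subs S.1# B.≋ T.1#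
  subs-1 zero    m = trans (subs-coefficient S.1# 0 m) (*-identityˡ _)
  subs-1 (suc j) m = trans (subs-coefficient S.1# (suc j) m) (*-zeroˡ ((Y ^ˢ suc j) m))

  -- The fraction 4zu / (1 - 2z) is twice 2zu / (1 - 2z), so the square root and the exponential are
  -- taken at the same argument and one substitution serves both.
  subs-1-2X : subs 1-2X B.≋ flip radicand
  subs-1-2X j m = begin
    subs 1-2X j m                                             ≡⟨ coefficient j ⟩
    T.1# j m - (B.monomial Y j m + B.monomial Y j m)          ≡⟨ cong₂ (λ a b → a - (b + b)) (flip-oneS j m) (flip-2zu/1-2z j m) ⟨
    oneS m j - (two * q + two * q)                            ≡⟨ cong (λ a → oneS m j - a) (*-distribʳ-+ q two two) ⟨
    oneS m j - four * q                                       ∎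
    where
    open ≡-Reasoning
    q = (zS *S uS *S inv1-2z) m j
    Y⊛0 : ∀ j → (Y ⊛ B.X (suc (suc j))) m ≡ 0ℚ
    Y⊛0 j = S.zeroʳ Y m
    coefficient : ∀ j → subs 1-2X j m ≡ T.1# j m - (B.monomial Y j m + B.monomial Y j m)
    coefficient zero          = trans (subs-coefficient 1-2X 0 m) (trans (*-identityˡ (S.1# m))
      (sym (trans (cong (λ a → S.1# m - (a + a)) (S.zeroʳ Y m)) (+-identityʳ (S.1# m)))))
    coefficient (suc zero)    = trans (subs-coefficient 1-2X 1 m) (trans (cong (1-2X 1 *_) (S.*-identityʳ Y m))
      (sym (trans (+-identityˡ _) (trans (cong (λ a → - (a + a)) (S.*-identityʳ Y m))
        (trans (cong -_ (sym (two*≡+ (Y m)))) (neg-distribˡ-* two (Y m)))))))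
    coefficient (suc (suc j)) = trans (subs-coefficient 1-2X (suc (suc j)) m) (trans (*-zeroˡ ((Y ^ˢ suc (suc j)) m))
      (sym (cong (λ a → 0ℚ - (a + a)) (Y⊛0 j))))

  flip-one-2z : flip one-2z B.≋ B.constS 1-2X
  flip-one-2z zero    zero          = refl
  flip-one-2z zero    (suc zero)    = refl
  flip-one-2z zero    (suc (suc m)) = refl
  flip-one-2z (suc j) zero          = refl
  flip-one-2z (suc j) (suc zero)    = refl
  flip-one-2z (suc j) (suc (suc m)) = refl

  -- The n-th power of Yu has degree n in u, so the coefficient of u^j sees only n = j, which the
  -- truncation at m + j includes.
  flip-expPart : flip expPart B.≋ subs expS₁
  flip-expPart j m = begin
    sumQ (m ℕ.+ j) (λ n → powS 2zu/1-2z n m j * invFact n)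
      ≡⟨ sumQ-cong (m ℕ.+ j) (λ n _ → cong (_* invFact n) (flip-pow-2zu/1-2z n j m)) ⟩
    sumQ (m ℕ.+ j) (λ n → (B.monomial Y ^ᵗ n) j m * invFact n)
      ≡⟨ sumQ-single (m ℕ.+ j) j _ (ℕ.m≤n+m j m) (λ n n≢j →
           trans (cong (_* invFact n) (B.monomial-^-offDiagonal Y n j n≢j m)) (*-zeroˡ (invFact n))) ⟩
    (B.monomial Y ^ᵗ j) j m * invFact j   ≡⟨ cong (_* invFact j) (B.monomial-^-diagonal Y j m) ⟩
    (Y ^ˢ j) m * invFact j                ≡⟨ *-comm _ (invFact j) ⟩
    invFact j * (Y ^ˢ j) m                ≡⟨ subs-coefficient expS₁ j m ⟨
    subs expS₁ j m                        ∎
    where open ≡-Reasoning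

  -- The relation Y = 2z (1 + Y), divided by z.
  tail-Y : tail Y ≋ Q.constS two ⊕ (λ n → two * Y n)
  tail-Y zero    = trans (cong (two *_) (Q.X-⊛-suc powersOfTwo 0))
    (sym (trans (cong (λ a → two + two * (two * a)) (Q.X-⊛-zero powersOfTwo)) refl))
  tail-Y (suc n) = begin
    two * (X ⊛ powersOfTwo) (suc (suc n))     ≡⟨ cong (two *_) (Q.X-⊛-suc powersOfTwo (suc n)) ⟩
    two * (powersOfTwo n + powersOfTwo n)     ≡⟨ cong (two *_) (two*≡+ (powersOfTwo n)) ⟨
    two * (two * powersOfTwo n)               ≡⟨ cong (λ a → two * (two * a)) (Q.X-⊛-suc powersOfTwo n) ⟨
    two * (two * (X ⊛ powersOfTwo) (suc n))   ≡⟨ +-identityˡ _ ⟨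
    0ℚ + two * Y (suc n)                      ∎
    where open ≡-Reasoning

  Y-⊛-zero : ∀ f → (Y ⊛ f) 0 ≡ 0ℚ
  Y-⊛-zero f = trans (cong (λ a → two * a * f 0) (Q.X-⊛-zero powersOfTwo)) (*-zeroˡ (f 0))

  Y-⊛-suc : ∀ f n → (Y ⊛ f) (suc n) ≡ two * f n + two * (Y ⊛ f) n
  Y-⊛-suc f n = begin
    Y 0 * f (suc n) + (tail Y ⊛ f) n          ≡⟨ cong (λ a → two * a * f (suc n) + (tail Y ⊛ f) n) (Q.X-⊛-zero powersOfTwo) ⟩
    0ℚ * f (suc n) + (tail Y ⊛ f) n           ≡⟨ cong (_+ (tail Y ⊛ f) n) (*-zeroˡ (f (suc n))) ⟩
    0ℚ + (tail Y ⊛ f) n                       ≡⟨ +-identityˡ _ ⟩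
    (tail Y ⊛ f) n                            ≡⟨ Q.⊛-cong {g = f} tail-Y (λ _ → refl) n ⟩
    ((Q.constS two ⊕ (λ k → two * Y k)) ⊛ f) n ≡⟨ Q.⊛-distribʳ f (Q.constS two) (λ k → two * Y k) n ⟩
    (Q.constS two ⊛ f) n + ((λ k → two * Y k) ⊛ f) n ≡⟨ cong₂ _+_ (Q.constS-⊛ two f n) (Q.⊛-scaleˡ two Y f n) ⟩
    two * f n + two * (Y ⊛ f) n               ∎
    where open ≡-Reasoning

  powersOfTwo≡2^n : ∀ n → powersOfTwo n ≡ fromℕQ (2 ℕ.^ n)
  powersOfTwo≡2^n zero    = refl
  powersOfTwo≡2^n (suc n) = begin
    powersOfTwo n + powersOfTwo n   ≡⟨ two*≡+ (powersOfTwo n) ⟨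
    two * powersOfTwo n             ≡⟨ cong (two *_) (powersOfTwo≡2^n n) ⟩
    two * fromℕQ (2 ℕ.^ n)          ≡⟨ fromℕQ-* 2 (2 ℕ.^ n) ⟨
    fromℕQ (2 ℕ.^ suc n)            ∎
    where open ≡-Reasoning

  -- (2z)^j / (1 - 2z)^{j+1}
  Y^j/1-2X : ∀ j m → (Y ^ˢ j ⊛ powersOfTwo) m ≡ fromℕQ (2 ℕ.^ m ℕ.* (m C j))
  Y^j/1-2X zero    m       = trans (S.*-identityˡ powersOfTwo m)
    (trans (powersOfTwo≡2^n m) (cong fromℕQ (sym (ℕ.*-identityʳ (2 ℕ.^ m)))))
  Y^j/1-2X (suc j) zero    = trans (S.*-assoc Y (Y ^ˢ j) powersOfTwo 0) (Y-⊛-zero (Y ^ˢ j ⊛ powersOfTwo))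
  Y^j/1-2X (suc j) (suc m) = begin
    (Y ^ˢ suc j ⊛ powersOfTwo) (suc m)        ≡⟨ S.*-assoc Y (Y ^ˢ j) powersOfTwo (suc m) ⟩
    (Y ⊛ K) (suc m)                           ≡⟨ Y-⊛-suc K m ⟩
    -- Both terms fall to the induction, at (j , m) and at (j + 1 , m). Once 2^m is taken out, their
    -- sum is Pascal's rule.
    two * K m + two * (Y ⊛ K) m               ≡⟨ cong₂ (λ a b → two * a + two * b) (Y^j/1-2X j m)
                                                   (trans (sym (S.*-assoc Y (Y ^ˢ j) powersOfTwo m)) (Y^j/1-2X (suc j) m)) ⟩
    two * fromℕQ (p ℕ.* (m C j)) + two * fromℕQ (p ℕ.* (m C suc j))
      ≡⟨ *-distribˡ-+ two (fromℕQ (p ℕ.* (m C j))) (fromℕQ (p ℕ.* (m C suc j))) ⟨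
    two * (fromℕQ (p ℕ.* (m C j)) + fromℕQ (p ℕ.* (m C suc j)))
      ≡⟨ cong (two *_) (fromℕQ-+ (p ℕ.* (m C j)) (p ℕ.* (m C suc j))) ⟨
    two * fromℕQ (p ℕ.* (m C j) ℕ.+ p ℕ.* (m C suc j))
      ≡⟨ fromℕQ-* 2 (p ℕ.* (m C j) ℕ.+ p ℕ.* (m C suc j)) ⟨
    fromℕQ (2 ℕ.* (p ℕ.* (m C j) ℕ.+ p ℕ.* (m C suc j)))
      ≡⟨ cong (λ a → fromℕQ (2 ℕ.* a)) (ℕ.*-distribˡ-+ p (m C j) (m C suc j)) ⟨
    fromℕQ (2 ℕ.* (p ℕ.* (m C j ℕ.+ m C suc j)))
      ≡⟨ cong fromℕQ (ℕ.*-assoc 2 p (m C j ℕ.+ m C suc j)) ⟨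
    fromℕQ (2 ℕ.^ suc m ℕ.* (m C j ℕ.+ m C suc j))
      ≡⟨ cong (λ a → fromℕQ (2 ℕ.^ suc m ℕ.* a)) (nCk+nC[k+1]≡[n+1]C[k+1] m j) ⟩
    fromℕQ (2 ℕ.^ suc m ℕ.* (suc m C suc j)) ∎
    where
    open ≡-Reasoning
    K = Y ^ˢ j ⊛ powersOfTwo
    p = 2 ℕ.^ m

  sqrtS : PS
  sqrtS = flip (subs sqrt)

  sqrtS*sqrtS : sqrtS *S sqrtS ≈PS radicand
  sqrtS*sqrtS m j = begin
    (sqrtS *S sqrtS) m j              ≡⟨ flip-*S sqrtS sqrtS j m ⟩
    (subs sqrt B.⊛ subs sqrt) j m     ≡⟨ subs-⊛ sqrt sqrt j m ⟩
    subs (sqrt ⊛ sqrt) j m            ≡⟨ subs-cong sqrt*sqrt≋1-2X j m ⟩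
    subs 1-2X j m                     ≡⟨ subs-1-2X j m ⟩
    radicand m j                      ∎
    where open ≡-Reasoning

  flip-numerator : ∀ F → (∀ m j → F m j ≡ derangements j * fromℕQ (2 ℕ.^ m ℕ.* (m C j))) →
    flip F B.≋ B.constS powersOfTwo B.⊛ subs derangements
  flip-numerator F F≡ j m = begin
    F m j                                             ≡⟨ F≡ m j ⟩
    derangements j * fromℕQ (2 ℕ.^ m ℕ.* (m C j))     ≡⟨ cong (derangements j *_) (Y^j/1-2X j m) ⟨
    derangements j * (Y ^ˢ j ⊛ powersOfTwo) m         ≡⟨ Q.⊛-scaleˡ (derangements j) (Y ^ˢ j) powersOfTwo m ⟨
    ((λ k → derangements j * (Y ^ˢ j) k) ⊛ powersOfTwo) m
      ≡⟨ Q.⊛-cong {g = powersOfTwo} (λ k → sym (subs-coefficient derangements j k)) (λ _ → refl) m ⟩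
    (D j ⊛ powersOfTwo) m                             ≡⟨ S.*-comm (D j) powersOfTwo m ⟩
    (powersOfTwo ⊛ D j) m                             ≡⟨ B.constS-⊛ powersOfTwo D j m ⟨
    (B.constS powersOfTwo B.⊛ D) j m                  ∎
    where
    open ≡-Reasoning
    D = subs derangements

  -- The counting enters the generating function only through the coefficient formula assumed of
  -- `F`.
  inverse-of-denominator : ∀ F →
    (∀ m j → F m j ≡ derangements j * fromℕQ (2 ℕ.^ m ℕ.* (m C j))) →
    F *S (one-2z *S sqrtS *S expPart) ≈PS oneS
  inverse-of-denominator F F≡ m j = trans (flipped j m) (sym (flip-oneS j m))
    where
    open SetoidReasoning T.setoid
    inv = B.constS powersOfTwo
    den = B.constS 1-2X
    D = subs derangements
    R = subs sqrt
    E = subs expS₁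

    flipped : flip (F *S (one-2z *S sqrtS *S expPart)) B.≋ T.1#
    flipped = begin
      flip (F *S (one-2z *S sqrtS *S expPart))
        ≈⟨ flip-*S F (one-2z *S sqrtS *S expPart) ⟩
      flip F B.⊛ flip (one-2z *S sqrtS *S expPart)
        ≈⟨ T.*-cong (flip-numerator F F≡) (T.trans (flip-*S (one-2z *S sqrtS) expPart)
             (T.*-cong (T.trans (flip-*S one-2z sqrtS) (T.*-congʳ {R} flip-one-2z)) flip-expPart)) ⟩
      inv B.⊛ D B.⊛ (den B.⊛ R B.⊛ E)
        -- Regrouping pairs each factor with its inverse: 1 - 2z with its reciprocal, and
        -- `derangements` with the square root times the exponential.
        ≈⟨ solveᵗ 5 (λ i d n r e → i ⊠ d ⊠ (n ⊠ r ⊠ e) ≐ n ⊠ i ⊠ (d ⊠ (r ⊠ e))) T.refl inv D den R E ⟩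
      den B.⊛ inv B.⊛ (D B.⊛ (R B.⊛ E))
        ≈⟨ T.*-cong (T.trans (T.sym (B.constS-* 1-2X powersOfTwo)) (constS-cong powersOfTwo-inverse))
             (T.trans (T.*-congˡ {D} (subs-⊛ sqrt expS₁))
               (T.trans (subs-⊛ derangements (sqrt ⊛ expS₁))
                 (T.trans (subs-cong derangements*sqrt*exp≋1) subs-1))) ⟩
      T.1# B.⊛ T.1#
        ≈⟨ T.*-identityˡ T.1# ⟩
      T.1# ∎

-- Finite sums and indicators of decidable properties.

module FiniteSums where

  open import Data.Bool using (Bool; true; false; T; if_then_else_; _∧_)
  open import Data.Bool.Properties using (T-∧; T?)
  open import Data.Nat using (ℕ; zero; suc; _+_; _*_; _≤_; z≤n)
  open import Data.Nat.Properties as ℕ hiding (_≟_)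
  open import Algebra.Properties.CommutativeSemigroup +-commutativeSemigroup using (interchange)
  open import Data.Fin as Fin using (Fin; zero; suc; _≟_)
  import Data.Fin.Properties as Fin
  open import Data.List using (List; []; _∷_; map; foldr; allFin; length)
  open import Data.List.Properties using (map-tabulate)
  open import Data.List.Membership.Propositional using (_∈_)
  open import Data.List.Membership.Propositional.Properties using (∈-allFin)
  open import Data.List.Relation.Unary.All using ([]; _∷_)
  open import Data.List.Relation.Unary.All.Properties using (All¬⇒¬Any)
  open import Data.List.Relation.Unary.Any using (here; there)
  open import Data.List.Relation.Unary.AllPairs using ([]; _∷_)
  open import Data.List.Relation.Unary.Unique.Propositional using (Unique)
  import Data.Vec.Functional as Vector
  open import Data.Product using (_,_; proj₁; proj₂)
  open import Data.Unit using (tt)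
  open import Function using (_∘_; Equivalence)
  open import Relation.Nullary
  open import Relation.Nullary.Decidable using (map′)
  open import Relation.Binary.PropositionalEquality

  private
    variable
      k m n : ℕ
      P P′ : Set

  ⟦_⟧ : Dec P → ℕ
  ⟦ d ⟧ = if does d then 1 else 0

  ⟦⟧-yes : (d : Dec P) → P → ⟦ d ⟧ ≡ 1
  ⟦⟧-yes (yes _) p = refl
  ⟦⟧-yes (no ¬p) p = contradiction p ¬p

  ⟦⟧-no : (d : Dec P) → ¬ P → ⟦ d ⟧ ≡ 0
  ⟦⟧-no (yes p) ¬p = contradiction p ¬p
  ⟦⟧-no (no _)  ¬p = refl

  ⟦⟧-cong : (d : Dec P) (e : Dec P′) → (P → P′) → (P′ → P) → ⟦ d ⟧ ≡ ⟦ e ⟧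
  ⟦⟧-cong (yes p) e f g = sym (⟦⟧-yes e (f p))
  ⟦⟧-cong (no ¬p) e f g = sym (⟦⟧-no e (¬p ∘ g))

  ⟦⟧-× : (d : Dec P) (e : Dec P′) → ⟦ d ×-dec e ⟧ ≡ ⟦ d ⟧ * ⟦ e ⟧
  ⟦⟧-× (yes _) (yes _) = refl
  ⟦⟧-× (yes _) (no _)  = refl
  ⟦⟧-× (no _)  e       = refl

  ⟦⟧-complement : (d : Dec P) → ⟦ ¬? d ⟧ + ⟦ d ⟧ ≡ 1
  ⟦⟧-complement (yes _) = refl
  ⟦⟧-complement (no _)  = refl

  ⟦⟧≤1 : (d : Dec P) → ⟦ d ⟧ ≤ 1
  ⟦⟧≤1 (yes _) = ≤-refl
  ⟦⟧≤1 (no _)  = z≤n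

  -- Under a sum, the indicator hands over its condition: the other factors have to agree only where
  -- it holds.
  ⟦⟧-*-cong : (d : Dec P) {a b : ℕ} → (P → a ≡ b) → ⟦ d ⟧ * a ≡ ⟦ d ⟧ * b
  ⟦⟧-*-cong (yes p) eq = cong (_+ 0) (eq p)
  ⟦⟧-*-cong (no _)  eq = refl

  sumFin-suc : ∀ n (f : Fin (suc n) → ℕ) → sumFin (suc n) f ≡ f zero + sumFin n (f ∘ suc)
  sumFin-suc n f = cong (λ xs → f zero + foldr _+_ 0 xs)
    (trans (map-tabulate suc f) (sym (map-tabulate (λ i → i) (f ∘ suc))))

  sumFin-cong : ∀ n {f g : Fin n → ℕ} → f ≗ g → sumFin n f ≡ sumFin n g
  sumFin-cong zero    p = refl
  sumFin-cong (suc n) {f} {g} p = trans (sumFin-suc n f)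
    (trans (cong₂ _+_ (p zero) (sumFin-cong n (p ∘ suc))) (sym (sumFin-suc n g)))

  sumFin-const : ∀ n a → sumFin n (λ _ → a) ≡ n * a
  sumFin-const zero    a = refl
  sumFin-const (suc n) a = trans (sumFin-suc n (λ _ → a)) (cong (a +_) (sumFin-const n a))

  sumFin-zero : ∀ n {f : Fin n → ℕ} → (∀ i → f i ≡ 0) → sumFin n f ≡ 0
  sumFin-zero n p = trans (sumFin-cong n p) (trans (sumFin-const n 0) (*-zeroʳ n))

  sumFin-+ : ∀ n (f g : Fin n → ℕ) → sumFin n (λ i → f i + g i) ≡ sumFin n f + sumFin n g
  sumFin-+ zero    f g = refl
  sumFin-+ (suc n) f g = begin
    sumFin (suc n) (λ i → f i + g i)                                   ≡⟨ sumFin-suc n (λ i → f i + g i) ⟩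
    f zero + g zero + sumFin n (λ i → f (suc i) + g (suc i))           ≡⟨ cong (f zero + g zero +_) (sumFin-+ n (f ∘ suc) (g ∘ suc)) ⟩
    f zero + g zero + (sumFin n (f ∘ suc) + sumFin n (g ∘ suc))        ≡⟨ interchange (f zero) (g zero) _ _ ⟩
    f zero + sumFin n (f ∘ suc) + (g zero + sumFin n (g ∘ suc))        ≡⟨ cong₂ _+_ (sumFin-suc n f) (sumFin-suc n g) ⟨
    sumFin (suc n) f + sumFin (suc n) g                                ∎
    where open ≡-Reasoning

  sumFin-*ʳ : ∀ n (f : Fin n → ℕ) a → sumFin n (λ i → f i * a) ≡ sumFin n f * a
  sumFin-*ʳ zero    f a = refl
  sumFin-*ʳ (suc n) f a = begin
    sumFin (suc n) (λ i → f i * a)                 ≡⟨ sumFin-suc n (λ i → f i * a) ⟩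
    f zero * a + sumFin n (λ i → f (suc i) * a)    ≡⟨ cong (f zero * a +_) (sumFin-*ʳ n (f ∘ suc) a) ⟩
    f zero * a + sumFin n (f ∘ suc) * a            ≡⟨ *-distribʳ-+ a (f zero) (sumFin n (f ∘ suc)) ⟨
    (f zero + sumFin n (f ∘ suc)) * a              ≡⟨ cong (_* a) (sumFin-suc n f) ⟨
    sumFin (suc n) f * a                           ∎
    where open ≡-Reasoning

  sumFin-swap : ∀ m n (f : Fin m → Fin n → ℕ) →
    sumFin m (λ i → sumFin n (f i)) ≡ sumFin n (λ j → sumFin m (λ i → f i j))
  sumFin-swap zero    n f = sym (sumFin-zero n (λ _ → refl))
  sumFin-swap (suc m) n f = begin
    sumFin (suc m) (λ i → sumFin n (f i))
      ≡⟨ sumFin-suc m (λ i → sumFin n (f i)) ⟩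
    sumFin n (f zero) + sumFin m (λ i → sumFin n (f (suc i)))
      ≡⟨ cong (sumFin n (f zero) +_) (sumFin-swap m n (f ∘ suc)) ⟩
    sumFin n (f zero) + sumFin n (λ j → sumFin m (λ i → f (suc i) j))
      ≡⟨ sumFin-+ n (f zero) (λ j → sumFin m (λ i → f (suc i) j)) ⟨
    sumFin n (λ j → f zero j + sumFin m (λ i → f (suc i) j))
      ≡⟨ sumFin-cong n (λ j → sym (sumFin-suc m (λ i → f i j))) ⟩
    sumFin n (λ j → sumFin (suc m) (λ i → f i j)) ∎
    where open ≡-Reasoning

  sumFin-mono : ∀ n {f g : Fin n → ℕ} → (∀ i → f i ≤ g i) → sumFin n f ≤ sumFin n g
  sumFin-mono zero    p = z≤n
  sumFin-mono (suc n) {f} {g} p = subst₂ _≤_ (sym (sumFin-suc n f)) (sym (sumFin-suc n g))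
    (+-mono-≤ (p zero) (sumFin-mono n (p ∘ suc)))

  sumFin-single : ∀ n (a : Fin n) → sumFin n (λ i → ⟦ i ≟ a ⟧) ≡ 1
  sumFin-single (suc n) zero    = trans (sumFin-suc n (λ i → ⟦ i ≟ zero ⟧)) (cong suc (sumFin-zero n (λ _ → refl)))
  sumFin-single (suc n) (suc a) = trans (sumFin-suc n (λ i → ⟦ i ≟ suc a ⟧))
    (trans (sumFin-cong n (λ i → ⟦⟧-cong (suc i ≟ suc a) (i ≟ a) Fin.suc-injective (cong suc))) (sumFin-single n a))

  sumFun-cong : ∀ k n {F G : (Fin k → Fin n) → ℕ} → F ≗ G → sumFun k n F ≡ sumFun k n G
  sumFun-cong zero    n p = p _
  sumFun-cong (suc k) n p = sumFin-cong n (λ i → sumFun-cong k n (λ g → p (i Vector.∷ g)))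

  sumFun-zero : ∀ k n {F : (Fin k → Fin n) → ℕ} → (∀ α → F α ≡ 0) → sumFun k n F ≡ 0
  sumFun-zero zero    n p = p _
  sumFun-zero (suc k) n p = sumFin-zero n (λ i → sumFun-zero k n (λ g → p (i Vector.∷ g)))

  sumFun-*ʳ : ∀ k n (F : (Fin k → Fin n) → ℕ) a → sumFun k n (λ α → F α * a) ≡ sumFun k n F * a
  sumFun-*ʳ zero    n F a = refl
  sumFun-*ʳ (suc k) n F a = trans (sumFin-cong n (λ i → sumFun-*ʳ k n (λ g → F (i Vector.∷ g)) a))
    (sumFin-*ʳ n (λ i → sumFun k n (λ g → F (i Vector.∷ g))) a)

  sumFun-swap : ∀ k n m (F : (Fin k → Fin n) → Fin m → ℕ) →
    sumFun k n (λ α → sumFin m (F α)) ≡ sumFin m (λ j → sumFun k n (λ α → F α j))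
  sumFun-swap zero    n m F = refl
  sumFun-swap (suc k) n m F = trans
    (sumFin-cong n (λ i → sumFun-swap k n m (λ g → F (i Vector.∷ g))))
    (sumFin-swap n m (λ i j → sumFun k n (λ g → F (i Vector.∷ g) j)))

  -- Functions are compared pointwise, since those enumerated by `sumFun` are built with `∷` and
  -- match `α₀` only extensionally.
  sumFun-single : ∀ k n (α₀ : Fin k → Fin n) →
    sumFun k n (λ α → ⟦ Fin.all? (λ x → α x ≟ α₀ x) ⟧) ≡ 1
  sumFun-single zero    n α₀ = refl
  sumFun-single (suc k) n α₀ = begin
    sumFin n (λ i → sumFun k n (λ g → ⟦ Fin.all? (λ x → (i Vector.∷ g) x ≟ α₀ x) ⟧))
      ≡⟨ sumFin-cong n (λ i → sumFun-cong k n (λ g → trans (split i g) (*-comm ⟦ i ≟ α₀ zero ⟧ _))) ⟩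
    sumFin n (λ i → sumFun k n (λ g → ⟦ tail? g ⟧ * ⟦ i ≟ α₀ zero ⟧))
      ≡⟨ sumFin-cong n (λ i → sumFun-*ʳ k n (λ g → ⟦ tail? g ⟧) ⟦ i ≟ α₀ zero ⟧) ⟩
    sumFin n (λ i → sumFun k n (λ g → ⟦ tail? g ⟧) * ⟦ i ≟ α₀ zero ⟧)
      ≡⟨ sumFin-cong n (λ i → trans (cong (_* ⟦ i ≟ α₀ zero ⟧) (sumFun-single k n (α₀ ∘ suc))) (*-identityˡ _)) ⟩
    sumFin n (λ i → ⟦ i ≟ α₀ zero ⟧)
      ≡⟨ sumFin-single n (α₀ zero) ⟩
    1 ∎
    where
    open ≡-Reasoning
    tail? : (g : Fin k → Fin n) → Dec (∀ x → g x ≡ α₀ (suc x))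
    tail? g = Fin.all? (λ x → g x ≟ α₀ (suc x))
    split : ∀ i g → ⟦ Fin.all? (λ x → (i Vector.∷ g) x ≟ α₀ x) ⟧ ≡ ⟦ i ≟ α₀ zero ⟧ * ⟦ tail? g ⟧
    split i g = trans
      (⟦⟧-cong (Fin.all? (λ x → (i Vector.∷ g) x ≟ α₀ x)) ((i ≟ α₀ zero) ×-dec tail? g)
        (λ h → h zero , h ∘ suc) (λ { (p , q) zero → p ; (p , q) (suc x) → q x }))
      (⟦⟧-× (i ≟ α₀ zero) (tail? g))

  -- An arbitrary decision procedure is allowed, so that the one for `x ∷ xs` need not be unfolded
  -- in the induction.
  sumFin-unique : {xs : List (Fin n)} (_∈?xs : ∀ a → Dec (a ∈ xs)) → Unique xs →
    sumFin n (λ a → ⟦ a ∈?xs ⟧) ≡ length xs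
  sumFin-unique {xs = []}     _∈?xs []         = sumFin-zero _ (λ a → ⟦⟧-no (a ∈?xs) (λ ()))
  sumFin-unique {n} {xs = x ∷ xs} _∈?xs (x∉ ∷ u) = begin
    sumFin n (λ a → ⟦ a ∈?xs ⟧)                          ≡⟨ sumFin-cong n split ⟩
    sumFin n (λ a → ⟦ a ≟ x ⟧ + ⟦ a ∈? xs ⟧)             ≡⟨ sumFin-+ n (λ a → ⟦ a ≟ x ⟧) (λ a → ⟦ a ∈? xs ⟧) ⟩
    sumFin n (λ a → ⟦ a ≟ x ⟧) + sumFin n (λ a → ⟦ a ∈? xs ⟧)
      ≡⟨ cong₂ _+_ (sumFin-single n x) (sumFin-unique (_∈? xs) u) ⟩
    suc (length xs)                                      ∎
    where
    open ≡-Reasoning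
    open import Data.List.Membership.DecPropositional (Fin._≟_ {n}) using (_∈?_)
    split : ∀ a → ⟦ a ∈?xs ⟧ ≡ ⟦ a ≟ x ⟧ + ⟦ a ∈? xs ⟧
    split a with a ≟ x
    ... | yes refl = trans (⟦⟧-yes (a ∈?xs) (here refl))
                       (cong suc (sym (⟦⟧-no (a ∈? xs) (All¬⇒¬Any x∉))))
    ... | no a≢x   = ⟦⟧-cong (a ∈?xs) (a ∈? xs)
                       (λ { (here eq) → contradiction eq a≢x ; (there p) → p }) there

  Injective : (Fin n → Fin n) → Set
  Injective α = ∀ {x y} → α x ≡ α y → x ≡ y

  module _ {A : Set} (g : A → Bool) where
    foldr-∧⁺ : (∀ x → T (g x)) → ∀ xs → T (foldr _∧_ true (map g xs))
    foldr-∧⁺ h []       = tt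
    foldr-∧⁺ h (x ∷ xs) = Equivalence.from T-∧ (h x , foldr-∧⁺ h xs)

    foldr-∧⁻ : ∀ {x xs} → T (foldr _∧_ true (map g xs)) → x ∈ xs → T (g x)
    foldr-∧⁻ h (here refl) = proj₁ (Equivalence.to T-∧ h)
    foldr-∧⁻ h (there p)   = foldr-∧⁻ (proj₂ (Equivalence.to T-∧ h)) p

  -- Built so that its `does` is `isPerm α` itself; the test in `c` then matches this decision by
  -- computation.
  injective? : (α : Fin n → Fin n) → Dec (Injective α)
  injective? {n} α = map′ sound complete (T? (isPerm α))
    where
    test : Fin n → Fin n → Bool
    test a b = if does (a ≟ b) then true else (if does (α a ≟ α b) then false else true)
    row : Fin n → Bool
    row a = foldr _∧_ true (map (test a) (allFin n))
    sound : T (isPerm α) → Injective α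
    sound h {x} {y} eq with x ≟ y | α x ≟ α y | foldr-∧⁻ (test x) {xs = allFin n} (foldr-∧⁻ row {xs = allFin n} h (∈-allFin x)) (∈-allFin y)
    ... | yes x≡y | _        | _  = x≡y
    ... | no _    | no αx≢αy | _  = contradiction eq αx≢αy
    complete : Injective α → T (isPerm α)
    complete inj = foldr-∧⁺ row (λ a → foldr-∧⁺ (test a) (entry a) (allFin n)) (allFin n)
      where
      entry : ∀ a b → T (test a b)
      entry a b with a ≟ b | α a ≟ α b
      ... | yes _  | _     = tt
      ... | no a≢b | yes e = contradiction (inj e) a≢b
      ... | no _   | no _  = tt

-- Counting the permutations that extend a partial injection by their commuting points.

module CommutingPermutations where

  open import Data.Nat as ℕ using (ℕ; zero; suc; _+_; _*_; _≤_; _!; s≤s)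
  open import Data.Nat.Properties as ℕ hiding (_≟_)
  open import Data.Fin as Fin using (Fin; zero; suc; _≟_; toℕ; fromℕ<)
  import Data.Fin.Properties as Fin
  open import Data.List using (List; []; _∷_; map; length)
  open import Data.List.Properties using (length-map)
  open import Data.List.Membership.Propositional using (_∈_; _∉_)
  open import Data.List.Membership.Propositional.Properties using (∈-map⁺; ∈-map⁻)
  open import Data.List.Relation.Unary.All as All using (All; []; _∷_)
  open import Data.List.Relation.Unary.All.Properties using (¬Any⇒All¬; All¬⇒¬Any)
  open import Data.List.Relation.Unary.Any using (here; there)
  open import Data.List.Relation.Unary.AllPairs using ([]; _∷_)
  open import Data.List.Relation.Unary.Unique.Propositional using (Unique)
  open import Data.Product using (∃; _×_; _,_; proj₁; proj₂)
  open import Relation.Nullary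
  open import Relation.Binary.PropositionalEquality
  open FiniteSums

  Unique-map-injective : ∀ {A B : Set} {f : A → B} {xs x y} → Unique (map f xs) →
    x ∈ xs → y ∈ xs → f x ≡ f y → x ≡ y
  Unique-map-injective u       (here refl) (here refl) eq = refl
  Unique-map-injective {f = f} {_ ∷ xs} (x∉ ∷ u) (here refl) (there q) eq =
    contradiction (subst (_∈ map f xs) (sym eq) (∈-map⁺ f q)) (All¬⇒¬Any x∉)
  Unique-map-injective {f = f} {_ ∷ xs} (x∉ ∷ u) (there p) (here refl) eq =
    contradiction (subst (_∈ map f xs) eq (∈-map⁺ f p)) (All¬⇒¬Any x∉)
  Unique-map-injective (_ ∷ u) (there p)   (there q)   eq = Unique-map-injective u p q eq

  module Counting {n : ℕ} where

    open import Data.List.Membership.DecPropositional (Fin._≟_ {n}) using (_∈?_)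

    count : {P : (Fin n → Fin n) → Set} → (∀ α → Dec (P α)) → ℕ
    count P? = sumFun n n (λ α → ⟦ P? α ⟧)

    module _ {P Q : (Fin n → Fin n) → Set} (P? : ∀ α → Dec (P α)) (Q? : ∀ α → Dec (Q α)) where

      count-cong : (∀ α → P α → Q α) → (∀ α → Q α → P α) → count P? ≡ count Q?
      count-cong f g = sumFun-cong n n (λ α → ⟦⟧-cong (P? α) (Q? α) (f α) (g α))

    module _ {P : (Fin n → Fin n) → Set} (P? : ∀ α → Dec (P α)) where

      count-none : (∀ α → ¬ P α) → count P? ≡ 0
      count-none ¬p = sumFun-zero n n (λ α → ⟦⟧-no (P? α) (¬p α))

      -- Inserts 1 as the sum over b of the indicator of b = α a. The equation has this orientation
      -- so that matching `refl` replaces the variable b.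
      count-value : ∀ a → count P? ≡ sumFin n (λ b → count (λ α → P? α ×-dec (b ≟ α a)))
      count-value a = trans
        (sumFun-cong n n (λ α → begin
          ⟦ P? α ⟧                                             ≡⟨ *-identityˡ _ ⟨
          1 * ⟦ P? α ⟧                                         ≡⟨ cong (_* ⟦ P? α ⟧) (sumFin-single n (α a)) ⟨
          sumFin n (λ b → ⟦ b ≟ α a ⟧) * ⟦ P? α ⟧              ≡⟨ sumFin-*ʳ n (λ b → ⟦ b ≟ α a ⟧) ⟦ P? α ⟧ ⟨
          sumFin n (λ b → ⟦ b ≟ α a ⟧ * ⟦ P? α ⟧)              ≡⟨ sumFin-cong n (λ b → trans (*-comm ⟦ b ≟ α a ⟧ _)
                                                                    (sym (⟦⟧-× (P? α) (b ≟ α a)))) ⟩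
          sumFin n (λ b → ⟦ P? α ×-dec (b ≟ α a) ⟧)            ∎))
        (sumFun-swap n n n (λ α b → ⟦ P? α ×-dec (b ≟ α a) ⟧))
        where open ≡-Reasoning

    Graph : Set
    Graph = List (Fin n × Fin n)

    dom ran : Graph → List (Fin n)
    dom = map proj₁
    ran = map proj₂

    outside : List (Fin n) → Fin n → ℕ
    outside xs a = ⟦ ¬? (a ∈? xs) ⟧

    sumFin-outside : ∀ {xs r} → Unique xs → length xs + r ≡ n → sumFin n (outside xs) ≡ r
    sumFin-outside {xs} {r} u len = +-cancelˡ-≡ (length xs) _ _ (begin
      length xs + sumFin n (outside xs)                         ≡⟨ +-comm (length xs) _ ⟩
      sumFin n (outside xs) + length xs                         ≡⟨ cong (sumFin n (outside xs) +_) (sumFin-unique (_∈? xs) u) ⟨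
      sumFin n (outside xs) + sumFin n (λ a → ⟦ a ∈? xs ⟧)      ≡⟨ sumFin-+ n (outside xs) (λ a → ⟦ a ∈? xs ⟧) ⟨
      sumFin n (λ a → outside xs a + ⟦ a ∈? xs ⟧)               ≡⟨ sumFin-cong n (λ a → ⟦⟧-complement (a ∈? xs)) ⟩
      sumFin n (λ _ → 1)                                        ≡⟨ trans (sumFin-const n 1) (*-identityʳ n) ⟩
      n                                                         ≡⟨ len ⟨
      length xs + r                                             ∎)
      where open ≡-Reasoning

    -- Pigeonhole: a missing point would give n + 1 distinct elements of `Fin n`.
    ∈-full : ∀ {xs} → Unique xs → length xs ≡ n → ∀ a → a ∈ xs
    ∈-full {xs} u len a with a ∈? xs
    ... | yes a∈xs = a∈xs
    ... | no a∉xs  = contradiction (begin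
        suc (length xs)                       ≡⟨ sumFin-unique (_∈? (a ∷ xs)) (¬Any⇒All¬ xs a∉xs ∷ u) ⟨
        sumFin n (λ b → ⟦ b ∈? (a ∷ xs) ⟧)    ≤⟨ sumFin-mono n (λ b → ⟦⟧≤1 (b ∈? (a ∷ xs))) ⟩
        sumFin n (λ _ → 1)                    ≡⟨ trans (sumFin-const n 1) (*-identityʳ n) ⟩
        n                                     ≡⟨ len ⟨
        length xs                             ∎) 1+n≰n
      where
      open ≤-Reasoning

    fresh : ∀ {xs r} → Unique xs → length xs + suc r ≡ n → ∃ λ a → a ∉ xs
    fresh {xs} {r} u len with Fin.all? (_∈? xs)
    ... | no ¬all = Fin.¬∀⟶∃¬ n (_∈ xs) (_∈? xs) ¬all
    ... | yes all = contradiction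
      (trans (sym (sumFin-zero n (λ a → ⟦⟧-no (¬? (a ∈? xs)) (λ a∉ → a∉ (all a))))) (sumFin-outside u len)) λ ()

    record IsPartialInjection (R : Graph) : Set where
      constructor _,_
      field
        dom-unique : Unique (dom R)
        ran-unique : Unique (ran R)
    open IsPartialInjection

    ∷-isPartialInjection : ∀ {R a b} → IsPartialInjection R → a ∉ dom R → b ∉ ran R →
      IsPartialInjection ((a , b) ∷ R)
    ∷-isPartialInjection (u , v) a∉ b∉ = (¬Any⇒All¬ _ a∉ ∷ u) , (¬Any⇒All¬ _ b∉ ∷ v)

    ∈-dom⁻ : ∀ {R a} → a ∈ dom R → ∃ λ b → (a , b) ∈ R
    ∈-dom⁻ a∈ with ∈-map⁻ proj₁ a∈
    ... | (_ , b) , p , refl = b , p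

    ∈-ran⁻ : ∀ {R b} → b ∈ ran R → ∃ λ a → (a , b) ∈ R
    ∈-ran⁻ b∈ with ∈-map⁻ proj₂ b∈
    ... | (a , _) , p , refl = a , p

    _Extends_ : (Fin n → Fin n) → Graph → Set
    α Extends R = All (λ (x , y) → α x ≡ y) R

    extends? : ∀ R α → Dec (α Extends R)
    extends? R α = All.all? (λ (x , y) → α x ≟ y) R

    apply : ∀ {α R x y} → α Extends R → (x , y) ∈ R → α x ≡ y
    apply ext p = All.lookup ext p

    value-∉-ran : ∀ {α R a} → Injective α → α Extends R → a ∉ dom R → α a ∉ ran R
    value-∉-ran {R = R} inj ext a∉ αa∈ with ∈-ran⁻ {R} αa∈
    ... | x , p = a∉ (subst (_∈ dom R) (inj (apply ext p)) (∈-map⁺ proj₁ p))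

    injectiveExtension? : ∀ R α → Dec (Injective α × α Extends R)
    injectiveExtension? R α = injective? α ×-dec extends? R α

    -- Here `R` is the graph of a single function `α₀`, and the uniqueness of its range makes `α₀`
    -- injective.
    count-total : ∀ R → IsPartialInjection R → length R ≡ n → count (injectiveExtension? R) ≡ 1
    count-total R (u , v) len = trans
      (count-cong (injectiveExtension? R) (λ α → Fin.all? (λ x → α x ≟ α₀ x))
        (λ α (inj , ext) x → apply ext (α₀-∈ x))
        (λ α eq → (λ {x} {y} αx≡αy → cong proj₁ (Unique-map-injective v (α₀-∈ x) (α₀-∈ y)
                     (trans (sym (eq x)) (trans αx≡αy (eq y))))) ,
                  All.tabulate (λ {(x , y)} p → trans (eq x)
                    (cong proj₂ (Unique-map-injective u (α₀-∈ x) p refl)))))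
      (sumFun-single n n α₀)
      where
      value : ∀ x → ∃ λ y → (x , y) ∈ R
      value x = ∈-dom⁻ (∈-full u (trans (length-map proj₁ R) len) x)
      α₀ : Fin n → Fin n
      α₀ x = proj₁ (value x)
      α₀-∈ : ∀ x → (x , α₀ x) ∈ R
      α₀-∈ x = proj₂ (value x)

    -- The value at a fresh point a can be any of the r + 1 points outside `ran R`, and each choice
    -- leaves r free points.
    count-injectiveExtension : ∀ r R → IsPartialInjection R → length R + r ≡ n →
      count (injectiveExtension? R) ≡ r !
    count-injectiveExtension zero    R inj len = count-total R inj (trans (sym (+-identityʳ _)) len)
    count-injectiveExtension (suc r) R inj@(u , v) len
      with a , a∉ ← fresh u (trans (cong (_+ suc r) (length-map proj₁ R)) len) = begin
      count (injectiveExtension? R)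
        ≡⟨ count-value (injectiveExtension? R) a ⟩
      sumFin n (λ b → count (λ α → injectiveExtension? R α ×-dec (b ≟ α a)))
        ≡⟨ sumFin-cong n choose ⟩
      sumFin n (λ b → outside (ran R) b * r !)
        ≡⟨ sumFin-*ʳ n (outside (ran R)) (r !) ⟩
      sumFin n (outside (ran R)) * r !
        ≡⟨ cong (_* r !) (sumFin-outside v (trans (cong (_+ suc r) (length-map proj₂ R)) len)) ⟩
      suc r ! ∎
      where
      open ≡-Reasoning
      choose : ∀ b → count (λ α → injectiveExtension? R α ×-dec (b ≟ α a)) ≡ outside (ran R) b * r !
      choose b with b ∈? ran R
      ... | yes b∈ = count-none (λ α → injectiveExtension? R α ×-dec (b ≟ α a))
                       (λ { α ((inj , ext) , refl) → value-∉-ran inj ext a∉ b∈ })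
      ... | no b∉  = trans
        (count-cong (λ α → injectiveExtension? R α ×-dec (b ≟ α a)) (injectiveExtension? ((a , b) ∷ R))
          (λ { α ((inj , ext) , eq) → inj , sym eq ∷ ext })
          (λ { α (inj , eq ∷ ext) → (inj , ext) , sym eq }))
        (trans (count-injectiveExtension r ((a , b) ∷ R) (∷-isPartialInjection inj a∉ b∉)
                 (trans (sym (+-suc (length R) r)) len))
          (sym (*-identityˡ (r !))))

    module Commuting (β : Fin n → Fin n) (fpf : FPFInvolution β) where

      β∘β : ∀ a → β (β a) ≡ a
      β∘β = proj₁ fpf

      CommutesAt : (Fin n → Fin n) → Fin n → Set
      CommutesAt α a = α (β a) ≡ β (α a)

      commutesAt? : ∀ α a → Dec (CommutesAt α a)
      commutesAt? α a = α (β a) ≟ β (α a)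

      commutations : (Fin n → Fin n) → ℕ
      commutations α = sumFin n (λ a → ⟦ commutesAt? α a ⟧)

      -- The invariant of the recursion: it forces every extension of `R` to commute with β on all
      -- of `dom R`, and it keeps the complements of domain and range stable under β.
      Closed : Graph → Set
      Closed R = ∀ {x y} → (x , y) ∈ R → (β x , β y) ∈ R

      -- The β-closed graph forced by α a ≡ b together with commutation at a.
      extend : Fin n → Fin n → Graph → Graph
      extend a b R = (a , b) ∷ (β a , β b) ∷ R

      commutesOnDom : ∀ {α R a} → Closed R → α Extends R → a ∈ dom R → CommutesAt α a
      commutesOnDom {α} {R} closed ext a∈ with ∈-dom⁻ {R} a∈
      ... | b , p = trans (apply ext (closed p)) (cong β (sym (apply ext p)))

      ∉-dom-β : ∀ {R a} → Closed R → a ∉ dom R → β a ∉ dom R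
      ∉-dom-β {R} {a} closed a∉ βa∈ with ∈-dom⁻ {R} βa∈
      ... | y , p = a∉ (subst (_∈ dom R) (β∘β a) (∈-map⁺ proj₁ (closed p)))

      ∉-ran-β : ∀ {R b} → Closed R → b ∉ ran R → β b ∉ ran R
      ∉-ran-β {R} {b} closed b∉ βb∈ with ∈-ran⁻ {R} βb∈
      ... | x , p = b∉ (subst (_∈ ran R) (β∘β b) (∈-map⁺ proj₂ (closed p)))

      extend-isPartialInjection : ∀ {R a b} → IsPartialInjection R → Closed R →
        a ∉ dom R → b ∉ ran R → IsPartialInjection (extend a b R)
      extend-isPartialInjection {R} {a} {b} inj closed a∉ b∉ = ∷-isPartialInjection
        (∷-isPartialInjection inj (∉-dom-β {R} closed a∉) (∉-ran-β {R} closed b∉))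
        -- The two new pairs differ in both coordinates because β has no fixed point.
        (λ { (here eq) → proj₂ fpf a (sym eq) ; (there p) → a∉ p })
        (λ { (here eq) → proj₂ fpf b (sym eq) ; (there p) → b∉ p })

      extend-closed : ∀ {R a b} → Closed R → Closed (extend a b R)
      extend-closed closed (here refl)         = there (here refl)
      extend-closed closed (there (here refl)) = here (cong₂ _,_ (β∘β _) (β∘β _))
      extend-closed closed (there (there p))   = there (there (closed p))

      commutesOutside? : ∀ R α a → Dec (a ∉ dom R × CommutesAt α a)
      commutesOutside? R α a = ¬? (a ∈? dom R) ×-dec commutesAt? α a

      -- Closure makes every point of `dom R` commute, and uniqueness makes these exactly `length R`
      -- points.
      commutations-split : ∀ {α R} → IsPartialInjection R → Closed R → α Extends R →
        commutations α ≡ length R + sumFin n (λ a → ⟦ commutesOutside? R α a ⟧)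
      commutations-split {α} {R} inj closed ext = begin
        sumFin n (λ a → ⟦ commutesAt? α a ⟧)
          ≡⟨ sumFin-cong n split ⟩
        sumFin n (λ a → ⟦ a ∈? dom R ⟧ + ⟦ commutesOutside? R α a ⟧)
          ≡⟨ sumFin-+ n (λ a → ⟦ a ∈? dom R ⟧) (λ a → ⟦ commutesOutside? R α a ⟧) ⟩
        sumFin n (λ a → ⟦ a ∈? dom R ⟧) + sumFin n (λ a → ⟦ commutesOutside? R α a ⟧)
          ≡⟨ cong (_+ sumFin n (λ a → ⟦ commutesOutside? R α a ⟧))
               (trans (sumFin-unique (_∈? dom R) (dom-unique inj)) (length-map proj₁ R)) ⟩
        length R + sumFin n (λ a → ⟦ commutesOutside? R α a ⟧) ∎
        where
        open ≡-Reasoning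
        split : ∀ a → ⟦ commutesAt? α a ⟧ ≡ ⟦ a ∈? dom R ⟧ + ⟦ commutesOutside? R α a ⟧
        split a with a ∈? dom R
        ... | yes a∈ = ⟦⟧-yes (commutesAt? α a) (commutesOnDom closed ext a∈)
        ... | no _   = refl

      commutations≤n : ∀ α → commutations α ≤ n
      commutations≤n α = begin
        commutations α      ≤⟨ sumFin-mono n (λ a → ⟦⟧≤1 (commutesAt? α a)) ⟩
        sumFin n (λ _ → 1)  ≡⟨ trans (sumFin-const n 1) (*-identityʳ n) ⟩
        n                   ∎
        where
        open ≤-Reasoning

      extension? : ∀ R k α → Dec ((Injective α × α Extends R) × commutations α ≡ k)
      extension? R k α = injectiveExtension? R α ×-dec (commutations α ℕ.≟ k)

      -- For β-closed R all points of its domain commute, so p counts the others.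
      #ext : Graph → ℕ → ℕ
      #ext R p = count (extension? R (length R + p))

      module _ {R : Graph} (inj : IsPartialInjection R) (closed : Closed R) where

        -- Double counting of the pairs (α , a) with a outside the domain of R
        -- and α commuting with β at a.
        double-count : ∀ p →
          #ext R p * p ≡ sumFin n (λ a → sumFin n (λ b →
            outside (dom R) a * (outside (ran R) b * count (extension? (extend a b R) (length R + p)))))
        double-count p = begin
          #ext R p * p
            ≡⟨ sumFun-*ʳ n n (λ α → ⟦ P? α ⟧) p ⟨
          sumFun n n (λ α → ⟦ P? α ⟧ * p)
            -- For each α that is counted, p is its number of commuting points outside the domain,
            -- by `commutations-split`.
            ≡⟨ sumFun-cong n n (λ α → ⟦⟧-*-cong (P? α) (λ ((_ , ext) , eq) →
                 +-cancelˡ-≡ (length R) _ _ (trans (sym eq) (commutations-split inj closed ext)))) ⟩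
          sumFun n n (λ α → ⟦ P? α ⟧ * sumFin n (λ a → ⟦ commutesOutside? R α a ⟧))
            ≡⟨ sumFun-cong n n (λ α → distribute α) ⟩
          sumFun n n (λ α → sumFin n (λ a → ⟦ P? α ×-dec commutesOutside? R α a ⟧))
            ≡⟨ sumFun-swap n n n (λ α a → ⟦ P? α ×-dec commutesOutside? R α a ⟧) ⟩
          sumFin n (λ a → count (λ α → P? α ×-dec commutesOutside? R α a))
            ≡⟨ sumFin-cong n (λ a → trans (count-value (λ α → P? α ×-dec commutesOutside? R α a) a)
                 (sumFin-cong n (choose a))) ⟩
          sumFin n (λ a → sumFin n (λ b →
            outside (dom R) a * (outside (ran R) b * count (extension? (extend a b R) (length R + p))))) ∎
          where
          open ≡-Reasoning
          P? : ∀ α → Dec ((Injective α × α Extends R) × commutations α ≡ length R + p)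
          P? = extension? R (length R + p)
          distribute : ∀ α → ⟦ P? α ⟧ * sumFin n (λ a → ⟦ commutesOutside? R α a ⟧) ≡
                             sumFin n (λ a → ⟦ P? α ×-dec commutesOutside? R α a ⟧)
          distribute α = trans (*-comm ⟦ P? α ⟧ _) (trans
            (sym (sumFin-*ʳ n (λ a → ⟦ commutesOutside? R α a ⟧) ⟦ P? α ⟧))
            (sumFin-cong n (λ a → trans (*-comm ⟦ commutesOutside? R α a ⟧ ⟦ P? α ⟧)
              (sym (⟦⟧-× (P? α) (commutesOutside? R α a))))))
          Q? : ∀ a b α → Dec _
          Q? a b α = (P? α ×-dec commutesOutside? R α a) ×-dec (b ≟ α a)
          -- The decisions are parameters so that matching on them reduces the indicators on the
          -- right-hand side.
          choose′ : ∀ a b (d : Dec (a ∈ dom R)) (e : Dec (b ∈ ran R)) → count (Q? a b) ≡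
            ⟦ ¬? d ⟧ * (⟦ ¬? e ⟧ * count (extension? (extend a b R) (length R + p)))
          choose′ a b (yes a∈) e        = count-none (Q? a b) (λ { α ((_ , a∉ , _) , _) → a∉ a∈ })
          choose′ a b (no a∉) (yes b∈)  = count-none (Q? a b)
            (λ { α ((((inj , ext) , _) , _) , refl) → value-∉-ran inj ext a∉ b∈ })
          choose′ a b (no a∉) (no b∉)   = trans
            (count-cong (Q? a b) (extension? (extend a b R) (length R + p))
              -- Once b is α a, commutation at a is literally the prescription of the second pair of
              -- `extend`.
              (λ { α ((((inj , ext) , eq) , (_ , comm)) , refl) → (inj , refl ∷ comm ∷ ext) , eq })
              (λ { α ((inj , refl ∷ comm ∷ ext) , eq) → ((((inj , ext) , eq) , (a∉ , comm)) , refl) }))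
            (sym (trans (*-identityˡ _) (*-identityˡ _)))
          choose : ∀ a b → count (Q? a b) ≡
            outside (dom R) a * (outside (ran R) b * count (extension? (extend a b R) (length R + p)))
          choose a b = choose′ a b (a ∈? dom R) (b ∈? ran R)

  module Extensions {n : ℕ} (β : Fin n → Fin n) (fpf : FPFInvolution β) where
      open Counting {n}
      open Commuting β fpf
      open IsPartialInjection
      open import Data.List.Membership.DecPropositional (Fin._≟_ {n}) using (_∈?_)

      module _ {R : Graph} (inj : IsPartialInjection R) (closed : Closed R) {r} (len : length R + r ≡ n) where
        sumFin-outside² : ∀ (g : Fin n → Fin n → ℕ) v →
          (∀ {a b} → a ∉ dom R → b ∉ ran R → g a b ≡ v) →
          sumFin n (λ a → sumFin n (λ b → outside (dom R) a * (outside (ran R) b * g a b))) ≡ r * (r * v)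
        sumFin-outside² g v g≡v = begin
          sumFin n (λ a → sumFin n (λ b → outside (dom R) a * (outside (ran R) b * g a b)))
            ≡⟨ sumFin-cong n (λ a → sumFin-cong n (λ b →
                 ⟦⟧-*-cong (¬? (a ∈? dom R)) (λ a∉ → ⟦⟧-*-cong (¬? (b ∈? ran R)) (g≡v a∉)))) ⟩
          sumFin n (λ a → sumFin n (λ b → outside (dom R) a * (outside (ran R) b * v)))
            ≡⟨ sumFin-cong n (λ a → trans (sumFin-cong n (λ b → *-comm (outside (dom R) a) _))
                 (sumFin-*ʳ n (λ b → outside (ran R) b * v) (outside (dom R) a))) ⟩
          sumFin n (λ a → sumFin n (λ b → outside (ran R) b * v) * outside (dom R) a)
            ≡⟨ sumFin-cong n (λ a → trans (*-comm _ (outside (dom R) a))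
                 (cong (outside (dom R) a *_) (trans (sumFin-*ʳ n (outside (ran R)) v)
                   (cong (_* v) (sumFin-outside (ran-unique inj) (trans (cong (_+ r) (length-map proj₂ R)) len)))))) ⟩
          sumFin n (λ a → outside (dom R) a * (r * v))
            ≡⟨ sumFin-*ʳ n (outside (dom R)) (r * v) ⟩
          sumFin n (outside (dom R)) * (r * v)
            ≡⟨ cong (_* (r * v)) (sumFin-outside (dom-unique inj) (trans (cong (_+ r) (length-map proj₁ R)) len)) ⟩
          r * (r * v) ∎
          where open ≡-Reasoning

        -- Commuting points come in pairs a, β a: one of them outside the domain forces α to extend
        -- `extend a b R`, hence at least two.
        #ext-one : #ext R 1 ≡ 0
        #ext-one = begin
          #ext R 1       ≡⟨ *-identityʳ (#ext R 1) ⟨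
          #ext R 1 * 1   ≡⟨ double-count inj closed 1 ⟩
          _              ≡⟨ sumFin-outside² _ 0 (λ {a} {b} a∉ b∉ → count-none (extension? (extend a b R) (length R + 1))
                              (λ { α ((_ , ext) , eq) → tooFew a∉ b∉ ext eq })) ⟩
          r * (r * 0)    ≡⟨ cong (r *_) (*-zeroʳ r) ⟩
          r * 0          ≡⟨ *-zeroʳ r ⟩
          0              ∎
          where
          open ≡-Reasoning
          tooFew : ∀ {a b α} → a ∉ dom R → b ∉ ran R → α Extends extend a b R → ¬ (commutations α ≡ length R + 1)
          tooFew {a} {b} {α} a∉ b∉ ext eq = m+1+n≢m (suc (length R)) (begin
            suc (length R) + suc x   ≡⟨ +-suc (suc (length R)) x ⟩
            suc (suc (length R)) + x ≡⟨ commutations-split (extend-isPartialInjection inj closed a∉ b∉) (extend-closed closed) ext ⟨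
            commutations α           ≡⟨ eq ⟩
            length R + 1             ≡⟨ +-comm (length R) 1 ⟩
            suc (length R)           ∎)
            where x = sumFin n (λ c → ⟦ commutesOutside? (extend a b R) α c ⟧)

        -- The two points added by `extend` pass from the p + 2 counted outside the domain into the
        -- domain, and there are r² choices of (a , b).
        #ext-suc-suc : ∀ p v → (∀ {a b} → a ∉ dom R → b ∉ ran R → #ext (extend a b R) p ≡ v) →
          #ext R (suc (suc p)) * suc (suc p) ≡ r * (r * v)
        #ext-suc-suc p v eq = trans (double-count inj closed (suc (suc p))) (sumFin-outside² _ v
          (λ {a} {b} a∉ b∉ → trans
            (cong (λ k → count (extension? (extend a b R) k))
              (trans (+-suc (length R) (suc p)) (cong suc (+-suc (length R) p))))
            (eq a∉ b∉)))

        -- Every injective extension is counted for exactly one p, its number of commuting points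
        -- outside the domain. This is at most r because no more than n points commute in all.
        sum-#ext : sumFin (suc r) (λ p → #ext R (toℕ p)) ≡ r !
        sum-#ext = begin
          sumFin (suc r) (λ p → #ext R (toℕ p))
            ≡⟨ sumFun-swap n n (suc r) (λ α p → ⟦ extension? R (length R + toℕ p) α ⟧) ⟨
          sumFun n n (λ α → sumFin (suc r) (λ p → ⟦ extension? R (length R + toℕ p) α ⟧))
            ≡⟨ sumFun-cong n n collapse ⟩
          count (injectiveExtension? R)
            ≡⟨ count-injectiveExtension r R inj len ⟩
          r ! ∎
          where
          open ≡-Reasoning
          collapse : ∀ α → sumFin (suc r) (λ p → ⟦ extension? R (length R + toℕ p) α ⟧) ≡ ⟦ injectiveExtension? R α ⟧
          collapse α = begin
            sumFin (suc r) (λ p → ⟦ d ×-dec e p ⟧)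
              ≡⟨ sumFin-cong (suc r) (λ p → trans (⟦⟧-× d (e p)) (*-comm ⟦ d ⟧ ⟦ e p ⟧)) ⟩
            sumFin (suc r) (λ p → ⟦ e p ⟧ * ⟦ d ⟧)
              ≡⟨ sumFin-*ʳ (suc r) (λ p → ⟦ e p ⟧) ⟦ d ⟧ ⟩
            sumFin (suc r) (λ p → ⟦ e p ⟧) * ⟦ d ⟧
              ≡⟨ *-comm _ ⟦ d ⟧ ⟩
            ⟦ d ⟧ * sumFin (suc r) (λ p → ⟦ e p ⟧)
              ≡⟨ ⟦⟧-*-cong d exactlyOne ⟩
            ⟦ d ⟧ * 1
              ≡⟨ *-identityʳ ⟦ d ⟧ ⟩
            ⟦ d ⟧ ∎
            where
            d = injectiveExtension? R α
            e : ∀ p → Dec (commutations α ≡ length R + toℕ p)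
            e p = commutations α ℕ.≟ (length R + toℕ p)
            exactlyOne : Injective α × α Extends R → sumFin (suc r) (λ p → ⟦ e p ⟧) ≡ 1
            exactlyOne (_ , ext) = trans
              (sumFin-cong (suc r) (λ p → ⟦⟧-cong (e p) (p ≟ fromℕ< x<1+r)
                (λ eq → Fin.toℕ-injective (trans (+-cancelˡ-≡ (length R) _ _ (trans (sym eq) split))
                  (sym (Fin.toℕ-fromℕ< x<1+r))))
                (λ { refl → trans split (cong (length R +_) (sym (Fin.toℕ-fromℕ< x<1+r))) })))
              (sumFin-single (suc r) (fromℕ< x<1+r))
              where
              x = sumFin n (λ a → ⟦ commutesOutside? R α a ⟧)
              split : commutations α ≡ length R + x
              split = commutations-split inj closed ext
              x<1+r : x ℕ.< suc r
              x<1+r = s≤s (+-cancelˡ-≤ (length R) x r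
                (subst₂ _≤_ split (sym len) (commutations≤n α)))

      H+commutations : ∀ α → H (λ a → α (β a)) (λ a → β (α a)) + commutations α ≡ n
      H+commutations α = begin
        sumFin n (λ a → if does (d a) then 0 else 1) + sumFin n (λ a → ⟦ d a ⟧)
          ≡⟨ sumFin-+ n (λ a → if does (d a) then 0 else 1) (λ a → ⟦ d a ⟧) ⟨
        sumFin n (λ a → (if does (d a) then 0 else 1) + ⟦ d a ⟧)
          ≡⟨ sumFin-cong n (λ a → one (does (d a))) ⟩
        sumFin n (λ _ → 1)
          ≡⟨ trans (sumFin-const n 1) (*-identityʳ n) ⟩
        n ∎
        where
        open ≡-Reasoning
        open import Data.Bool using (Bool; true; false; if_then_else_)
        d = commutesAt? α
        one : ∀ b → (if b then 0 else 1) + (if b then 1 else 0) ≡ 1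
        one true  = refl
        one false = refl

      withDistance? : ∀ k α → Dec (Injective α × H (λ a → α (β a)) (λ a → β (α a)) ≡ k)
      withDistance? k α = injective? α ×-dec (H (λ a → α (β a)) (λ a → β (α a)) ℕ.≟ k)

      c≡count : ∀ k → c k β ≡ count (withDistance? k)
      c≡count k = sumFun-cong n n (λ α → nested (isPerm α) _)
        where
        open import Data.Bool using (Bool; true; false; if_then_else_; _∧_)
        nested : ∀ b b′ → (if b then (if b′ then 1 else 0) else 0) ≡ (if b ∧ b′ then 1 else 0)
        nested true  b′ = refl
        nested false b′ = refl

      -- The distance counts the points where α and β fail to commute, and every α extends the empty
      -- graph.
      c≡#ext : ∀ {k l} → k + l ≡ n → c k β ≡ #ext [] l
      c≡#ext {k} {l} k+l = trans (c≡count k) (count-cong (withDistance? k) (extension? [] l)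
        (λ α (inj , eq) → ((λ {x} {y} → inj {x} {y}) , []) , +-cancelˡ-≡ k _ _
          (trans (cong (_+ commutations α) (sym eq)) (trans (H+commutations α) (sym k+l))))
        (λ α ((inj , _) , eq) → (λ {x} {y} → inj {x} {y}) , +-cancelʳ-≡ l _ _
          (trans (cong (H (λ a → α (β a)) (λ a → β (α a)) +_) (sym eq)) (trans (H+commutations α) (sym k+l)))))
        where open import Data.List.Relation.Unary.All using ([])

      c-large : ∀ {k} → n ℕ.< k → c k β ≡ 0
      c-large {k} n<k = trans (c≡count k) (count-none (withDistance? k)
        (λ { α (_ , refl) → <⇒≱ n<k (subst (H (λ a → α (β a)) (λ a → β (α a)) ≤_) (H+commutations α) (m≤m+n _ _)) }))

-- Solving the recursion and the closed form of the coefficients.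

module Coefficients where

  open import Data.Nat as ℕ using (ℕ; zero; suc; _!; _∸_)
  import Data.Nat.Properties as ℕ
  import Data.Nat.DivMod as ℕ
  open import Data.Nat.Solver using (module +-*-Solver)
  open +-*-Solver using (con) renaming (solve to solveℕ; _:+_ to _⊞_; _:*_ to _⊠_; _:=_ to _≐_)
  open import Data.Nat.Combinatorics using (_C_; nCk≡n!/k![n-k]!; k![n∸k]!∣n!; k>n⇒nCk≡0)
  open import Data.Integer as ℤ using (+_)
  import Data.Integer.Properties as ℤ
  open import Data.Rational using (ℚ; 0ℚ; 1ℚ; _+_; _*_; _-_; -_; _/_)
  open import Data.Rational.Properties
  open import Data.Rational.Unnormalised using (mkℚᵘ; *≡*)
  open import Data.Fin using (Fin; zero; suc; toℕ)
  open import Data.List using ([]; length)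
  open import Data.List.Properties using (length-map)
  open import Data.List.Relation.Unary.AllPairs using ([])
  open import Data.List.Membership.Propositional using (_∉_)
  open import Data.Product using (_,_; proj₁; proj₂)
  open import Function using (_∘_; case_of_)
  open import Data.Sum using (inj₁; inj₂)
  open import Algebra.Bundles using (CommutativeRing)
  import Algebra.Solver.Ring.NaturalCoefficients.Default as SemiringSolver
  open import Relation.Nullary
  open import Relation.Binary.PropositionalEquality
  open PowerSeriesRings
  open RationalSeries
  open BivariateSeries
  open FiniteSums using (sumFin-suc)
  open CommutingPermutations

  open SemiringSolver (CommutativeRing.commutativeSemiring +-*-commutativeRing)
    using (solve; _:+_; _:*_; _:=_)

  fromℕQ-injective : ∀ {m n} → fromℕQ m ≡ fromℕQ n → m ≡ n
  fromℕQ-injective {m} {n} eq with *≡* e ← fromℚᵘ-injective {mkℚᵘ (+ m) 0} {mkℚᵘ (+ n) 0} eq =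
    ℤ.+-injective (trans (sym (ℤ.*-identityʳ (+ m))) (trans e (ℤ.*-identityʳ (+ n))))

  sumQ-cons : ∀ n f → sumQ (suc n) f ≡ f 0 + sumQ n (f ∘ suc)
  sumQ-cons n f = trans (sym (sum≤≡sumQ (suc n) f))
    (trans (Q.sum≤-cons n f) (cong (λ a → f 0 + a) (sum≤≡sumQ n (f ∘ suc))))

  sumQ-*ˡ : ∀ n p f → sumQ n (λ k → p * f k) ≡ p * sumQ n f
  sumQ-*ˡ zero    p f = refl
  sumQ-*ˡ (suc n) p f = trans (cong (_+ p * f (suc n)) (sumQ-*ˡ n p f)) (sym (*-distribˡ-+ p (sumQ n f) (f (suc n))))

  fromℕQ-sumFin : ∀ n f → fromℕQ (sumFin (suc n) (f ∘ toℕ)) ≡ sumQ n (fromℕQ ∘ f)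
  fromℕQ-sumFin zero    f = cong fromℕQ (ℕ.+-identityʳ (f 0))
  fromℕQ-sumFin (suc n) f = begin
    fromℕQ (sumFin (suc (suc n)) (f ∘ toℕ))
      ≡⟨ cong fromℕQ (sumFin-suc (suc n) (f ∘ toℕ)) ⟩
    fromℕQ (f 0 ℕ.+ sumFin (suc n) (f ∘ suc ∘ toℕ))
      ≡⟨ fromℕQ-+ (f 0) (sumFin (suc n) (f ∘ suc ∘ toℕ)) ⟩
    fromℕQ (f 0) + fromℕQ (sumFin (suc n) (f ∘ suc ∘ toℕ))
      ≡⟨ cong (λ a → fromℕQ (f 0) + a) (fromℕQ-sumFin n (f ∘ suc)) ⟩
    fromℕQ (f 0) + sumQ n (fromℕQ ∘ f ∘ suc)
      ≡⟨ sumQ-cons n (fromℕQ ∘ f) ⟨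
    sumQ (suc n) (fromℕQ ∘ f) ∎
    where open ≡-Reasoning

  -- Recovers the value at p = 0 from the total, where the recursion gives no information.
  sumQ-cancel : ∀ n {f g} → (∀ k → f (suc k) ≡ g (suc k)) → sumQ n f ≡ sumQ n g → f 0 ≡ g 0
  sumQ-cancel zero            p eq = eq
  sumQ-cancel (suc n) {f} {g} p eq = sumQ-cancel n p
    (+-cancelʳ (f (suc n)) (sumQ n f) (sumQ n g) (trans eq (cong (λ a → sumQ n g + a) (sym (p n)))))
    where
    open import Algebra.Properties.Group (CommutativeRing.+-group +-*-commutativeRing)
      using () renaming (∙-cancelʳ to +-cancelʳ)

  -- profile s (2k) = derangements (s - k) / k! for k ≤ s; the other values are 0.
  profile : ℕ → ℕ → ℚ
  profile s       zero          = derangements s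
  profile s       (suc zero)    = 0ℚ
  profile zero    (suc (suc p)) = 0ℚ
  profile (suc s) (suc (suc p)) = two * profile s p * ((+ 1) / suc (suc p))

  profile-odd : ∀ s k → profile s (suc (k ℕ.+ k)) ≡ 0ℚ
  profile-odd s       zero    = refl
  profile-odd zero    (suc k) = refl
  profile-odd (suc s) (suc k) = trans
    (cong (λ i → two * profile s i * ((+ 1) / suc (suc i))) (ℕ.+-suc k k))
    (trans (cong (λ a → two * a * ((+ 1) / suc (suc (suc (k ℕ.+ k))))) (profile-odd s k))
      (trans (cong (_* ((+ 1) / suc (suc (suc (k ℕ.+ k))))) (*-zeroʳ two)) (*-zeroˡ ((+ 1) / suc (suc (suc (k ℕ.+ k)))))))

  -- Each step of the recursion contributes 2 / (2k + 2) = 1 / (k + 1), so the factors build up 1 /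
  -- k!. Writing the index as k + s avoids subtraction.
  profile-even : ∀ k s → profile (k ℕ.+ s) (k ℕ.+ k) ≡ invFact k * derangements s
  profile-even zero    s = sym (*-identityˡ (derangements s))
  profile-even (suc k) s = fromℕQ-cancelˡ (suc (suc (k ℕ.+ k))) (begin
    fromℕQ (suc (suc (k ℕ.+ k))) * profile (suc (k ℕ.+ s)) (suc k ℕ.+ suc k)
      ≡⟨ cong (λ i → fromℕQ (suc (suc (k ℕ.+ k))) * profile (suc (k ℕ.+ s)) (suc i)) (ℕ.+-suc k k) ⟩
    fromℕQ (suc (suc (k ℕ.+ k))) * profile (suc (k ℕ.+ s)) (suc (suc (k ℕ.+ k)))
      ≡⟨ cancel-1/suc (suc (k ℕ.+ k)) (two * profile (k ℕ.+ s) (k ℕ.+ k)) ⟩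
    two * profile (k ℕ.+ s) (k ℕ.+ k)
      ≡⟨ cong (two *_) (profile-even k s) ⟩
    two * (invFact k * d)
      ≡⟨ cong (λ a → two * (a * d)) (invFact-suc k) ⟨
    two * (fromℕQ (suc k) * invFact (suc k) * d)
      ≡⟨ solve 4 (λ a b c e → a :* (b :* c :* e) := a :* b :* (c :* e)) refl two (fromℕQ (suc k)) (invFact (suc k)) d ⟩
    two * fromℕQ (suc k) * (invFact (suc k) * d)
      ≡⟨ cong (_* (invFact (suc k) * d)) (trans (sym (fromℕQ-* 2 (suc k))) (cong fromℕQ (double k))) ⟩
    fromℕQ (suc (suc (k ℕ.+ k))) * (invFact (suc k) * d) ∎)
    where
    open ≡-Reasoning
    d = derangements s
    double : ∀ k → 2 ℕ.* suc k ≡ suc (suc (k ℕ.+ k))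
    double = solveℕ 1 (λ k →
      con 2 ⊠ (con 1 ⊞ k) ≐ con 2 ⊞ (k ⊞ k)) refl

  -- The odd values vanish, and the even ones sum to the s-th coefficient of `derangements` times
  -- exp(x). The factor `exp⁻¹` in `derangements` is there to make this product `rsqrt`.
  sum-profile : ∀ s → sumQ (s ℕ.+ s) (profile s) ≡ rsqrt s
  sum-profile s = begin
    sumQ (s ℕ.+ s) (profile s)                          ≡⟨ evens s ⟩
    sumQ s (λ k → profile s (k ℕ.+ k))                  ≡⟨ sumQ-cong s (λ k k≤s →
        trans (cong (λ i → profile i (k ℕ.+ k)) (sym (ℕ.m+[n∸m]≡n k≤s))) (profile-even k (s ∸ k))) ⟩
    sumQ s (λ k → invFact k * derangements (s ∸ k))     ≡⟨ sum≤≡sumQ s _ ⟨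
    Q.sum≤ s (λ k → invFact k * derangements (s ∸ k))   ≡⟨ Q.⊛-coefficient expS₁ derangements s ⟨
    (expS₁ ⊛ derangements) s                            ≡⟨ S.*-comm expS₁ derangements s ⟩
    (derangements ⊛ expS₁) s                            ≡⟨ derangements*exp≋rsqrt s ⟩
    rsqrt s                                             ∎
    where
    open ≡-Reasoning
    evens : ∀ j → sumQ (j ℕ.+ j) (profile s) ≡ sumQ j (λ k → profile s (k ℕ.+ k))
    evens zero    = refl
    evens (suc j) = begin
      sumQ (suc j ℕ.+ suc j) (profile s)
        ≡⟨ cong (λ i → sumQ i (profile s)) (ℕ.+-suc (suc j) j) ⟩
      sumQ (j ℕ.+ j) (profile s) + profile s (suc (j ℕ.+ j)) + profile s (suc (suc (j ℕ.+ j)))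
        ≡⟨ cong (λ a → sumQ (j ℕ.+ j) (profile s) + a + profile s (suc (suc (j ℕ.+ j)))) (profile-odd s j) ⟩
      sumQ (j ℕ.+ j) (profile s) + 0ℚ + profile s (suc (suc (j ℕ.+ j)))
        ≡⟨ cong (_+ profile s (suc (suc (j ℕ.+ j)))) (+-identityʳ (sumQ (j ℕ.+ j) (profile s))) ⟩
      sumQ (j ℕ.+ j) (profile s) + profile s (suc (suc (j ℕ.+ j)))
        ≡⟨ cong₂ _+_ (evens j) (cong (λ i → profile s (suc i)) (sym (ℕ.+-suc j j))) ⟩
      sumQ (suc j) (λ k → profile s (k ℕ.+ k)) ∎

  -- Chosen so that (2s)² `scale (s - 1)` is twice `scale s`: dividing the counts by `scale s`
  -- leaves the constant `two` in the recursion of `profile` and turns (2s)! into a coefficient of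
  -- `rsqrt`.
  scale : ℕ → ℕ
  scale s = 2 ℕ.^ s ℕ.* (s ! ℕ.* s !)

  scale-suc : ∀ s → scale (suc s) ℕ.* 2 ≡ (suc s ℕ.+ suc s) ℕ.* ((suc s ℕ.+ suc s) ℕ.* scale s)
  scale-suc s = solveℕ 3 (λ s p f →
    con 2 ⊠ p ⊠ ((con 1 ⊞ s) ⊠ f ⊠ ((con 1 ⊞ s) ⊠ f)) ⊠ con 2
    ≐ (con 1 ⊞ s ⊞ (con 1 ⊞ s)) ⊠ ((con 1 ⊞ s ⊞ (con 1 ⊞ s)) ⊠ (p ⊠ (f ⊠ f)))) refl s (2 ℕ.^ s) (s !)

  -- In integers this is 2^s s! times 1·3·⋯·(2s-1), the product of the even and the odd factors of
  -- (2s)!.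
  scale*rsqrt : ∀ s → fromℕQ (scale s) * rsqrt s ≡ fromℕQ ((s ℕ.+ s) !)
  scale*rsqrt zero    = refl
  -- The factor 2 is inserted because `scale-suc` speaks of twice `scale (suc s)`.
  scale*rsqrt (suc s) = fromℕQ-cancelˡ 2 (begin
    two * (fromℕQ (scale (suc s)) * (fromℕQ (suc (s ℕ.+ s)) * rsqrt s * r))
      ≡⟨ solve 5 (λ w a b t r → w :* (a :* (b :* t :* r)) := (a :* w) :* b :* t :* r) refl
           two (fromℕQ (scale (suc s))) (fromℕQ (suc (s ℕ.+ s))) (rsqrt s) r ⟩
    (fromℕQ (scale (suc s)) * two) * fromℕQ (suc (s ℕ.+ s)) * rsqrt s * r
      ≡⟨ cong (λ a → a * fromℕQ (suc (s ℕ.+ s)) * rsqrt s * r) (begin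
           fromℕQ (scale (suc s)) * two              ≡⟨ fromℕQ-* (scale (suc s)) 2 ⟨
           fromℕQ (scale (suc s) ℕ.* 2)              ≡⟨ cong fromℕQ (trans (scale-suc s) (regroup s (scale s))) ⟩
           fromℕQ (suc s ℕ.* (2 ℕ.* (suc s ℕ.+ suc s)) ℕ.* scale s)
             ≡⟨ fromℕQ-* (suc s ℕ.* (2 ℕ.* (suc s ℕ.+ suc s))) (scale s) ⟩
           fromℕQ (suc s ℕ.* (2 ℕ.* (suc s ℕ.+ suc s))) * fromℕQ (scale s)
             ≡⟨ cong (_* fromℕQ (scale s)) (fromℕQ-* (suc s) (2 ℕ.* (suc s ℕ.+ suc s))) ⟩
           fromℕQ (suc s) * fromℕQ (2 ℕ.* (suc s ℕ.+ suc s)) * fromℕQ (scale s) ∎) ⟩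
    fromℕQ (suc s) * u * fromℕQ (scale s) * fromℕQ (suc (s ℕ.+ s)) * rsqrt s * r
      ≡⟨ solve 6 (λ n u a b t r → n :* u :* a :* b :* t :* r := n :* (u :* b :* (a :* t) :* r)) refl
           (fromℕQ (suc s)) u (fromℕQ (scale s)) (fromℕQ (suc (s ℕ.+ s))) (rsqrt s) r ⟩
    fromℕQ (suc s) * (u * fromℕQ (suc (s ℕ.+ s)) * (fromℕQ (scale s) * rsqrt s) * r)
      ≡⟨ cancel-1/suc s (u * fromℕQ (suc (s ℕ.+ s)) * (fromℕQ (scale s) * rsqrt s)) ⟩
    u * fromℕQ (suc (s ℕ.+ s)) * (fromℕQ (scale s) * rsqrt s)
      ≡⟨ cong (u * fromℕQ (suc (s ℕ.+ s)) *_) (scale*rsqrt s) ⟩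
    u * fromℕQ (suc (s ℕ.+ s)) * fromℕQ ((s ℕ.+ s) !)
      ≡⟨ *-assoc u (fromℕQ (suc (s ℕ.+ s))) (fromℕQ ((s ℕ.+ s) !)) ⟩
    u * (fromℕQ (suc (s ℕ.+ s)) * fromℕQ ((s ℕ.+ s) !))
      ≡⟨ cong (u *_) (fromℕQ-* (suc (s ℕ.+ s)) ((s ℕ.+ s) !)) ⟨
    u * fromℕQ (suc (s ℕ.+ s) !)
      ≡⟨ cong (_* fromℕQ (suc (s ℕ.+ s) !)) (fromℕQ-* 2 (suc s ℕ.+ suc s)) ⟩
    two * fromℕQ (suc s ℕ.+ suc s) * fromℕQ (suc (s ℕ.+ s) !)
      ≡⟨ *-assoc two (fromℕQ (suc s ℕ.+ suc s)) (fromℕQ (suc (s ℕ.+ s) !)) ⟩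
    two * (fromℕQ (suc s ℕ.+ suc s) * fromℕQ (suc (s ℕ.+ s) !))
      ≡⟨ cong (two *_) (fromℕQ-* (suc s ℕ.+ suc s) (suc (s ℕ.+ s) !)) ⟨
    two * fromℕQ ((suc s ℕ.+ suc s) ℕ.* suc (s ℕ.+ s) !)
      ≡⟨ cong (λ i → two * fromℕQ ((suc s ℕ.+ suc s) ℕ.* i !)) (ℕ.+-suc s s) ⟨
    two * fromℕQ ((suc s ℕ.+ suc s) !) ∎)
    where
    open ≡-Reasoning
    r = (+ 1) / suc s
    u = fromℕQ (2 ℕ.* (suc s ℕ.+ suc s))
    regroup : ∀ s c → (suc s ℕ.+ suc s) ℕ.* ((suc s ℕ.+ suc s) ℕ.* c) ≡ suc s ℕ.* (2 ℕ.* (suc s ℕ.+ suc s)) ℕ.* c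
    regroup = solveℕ 2 (λ s c →
      (con 1 ⊞ s ⊞ (con 1 ⊞ s)) ⊠ ((con 1 ⊞ s ⊞ (con 1 ⊞ s)) ⊠ c)
      ≐ (con 1 ⊞ s) ⊠ (con 2 ⊠ (con 1 ⊞ s ⊞ (con 1 ⊞ s))) ⊠ c) refl

  module _ {n : ℕ} (β : Fin n → Fin n) (fpf : FPFInvolution β) where
    open Counting {n}
    open Commuting β fpf
    open Extensions β fpf

    -- Mutual induction on s: the values at p + 2 come from p at s - 1, and the value at 0 from the
    -- total and all positive p at the same s. Quantifying over `R` shows that the count depends on
    -- the number of free points only, as `#ext-suc-suc` requires.
    #ext-formula : ∀ s p {R} → IsPartialInjection R → Closed R → length R ℕ.+ (s ℕ.+ s) ≡ n →
      fromℕQ (#ext R p) ≡ fromℕQ (scale s) * profile s p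
    #ext-formula-suc : ∀ s p {R} → IsPartialInjection R → Closed R → length R ℕ.+ (s ℕ.+ s) ≡ n →
      fromℕQ (#ext R (suc p)) ≡ fromℕQ (scale s) * profile s (suc p)

    #ext-formula s zero    {R} inj closed len = sumQ-cancel (s ℕ.+ s)
      {fromℕQ ∘ #ext R} {λ p → fromℕQ (scale s) * profile s p}
      (λ p → #ext-formula-suc s p inj closed len) (begin
      sumQ (s ℕ.+ s) (fromℕQ ∘ #ext R)                           ≡⟨ fromℕQ-sumFin (s ℕ.+ s) (#ext R) ⟨
      fromℕQ (sumFin (suc (s ℕ.+ s)) (#ext R ∘ toℕ))             ≡⟨ cong fromℕQ (sum-#ext inj closed len) ⟩
      fromℕQ ((s ℕ.+ s) !)                                       ≡⟨ scale*rsqrt s ⟨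
      fromℕQ (scale s) * rsqrt s                                 ≡⟨ cong (fromℕQ (scale s) *_) (sum-profile s) ⟨
      fromℕQ (scale s) * sumQ (s ℕ.+ s) (profile s)              ≡⟨ sumQ-*ˡ (s ℕ.+ s) (fromℕQ (scale s)) (profile s) ⟨
      sumQ (s ℕ.+ s) (λ p → fromℕQ (scale s) * profile s p)      ∎)
      where open ≡-Reasoning
    #ext-formula s (suc p) = #ext-formula-suc s p

    #ext-formula-suc s       zero    {R} inj closed len =
      trans (cong fromℕQ (#ext-one inj closed len)) (sym (*-zeroʳ (fromℕQ (scale s))))
    #ext-formula-suc zero    (suc p) {R} inj closed len =
      trans (cong fromℕQ (ℕ.m*n≡0⇒m≡0 (#ext R (suc (suc p))) (suc (suc p))
          -- With s = 0 the domain is everything, so there is no fresh a and the value 0 supplied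
          -- for the extended graphs is arbitrary.
          (#ext-suc-suc inj closed len p 0 (λ a∉ _ → contradiction
            (∈-full (IsPartialInjection.dom-unique inj) (trans (length-map proj₁ R) (trans (sym (ℕ.+-identityʳ _)) len)) _) a∉))))
        (sym (*-zeroʳ (fromℕQ (scale zero))))
    #ext-formula-suc (suc s) (suc p) {R} inj closed len = fromℕQ-cancelˡ (suc (suc p)) (begin
      fromℕQ (suc (suc p)) * fromℕQ (#ext R (suc (suc p)))
        ≡⟨ fromℕQ-* (suc (suc p)) (#ext R (suc (suc p))) ⟨
      fromℕQ (suc (suc p) ℕ.* #ext R (suc (suc p)))
        ≡⟨ cong fromℕQ (trans (ℕ.*-comm (suc (suc p)) (#ext R (suc (suc p)))) (#ext-suc-suc inj closed len p v
             (λ a∉ b∉ → fromℕQ-injective (trans (IH a∉ b∉) (sym (IH (proj₂ a₀) (proj₂ b₀))))))) ⟩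
      fromℕQ (r ℕ.* (r ℕ.* v))
        ≡⟨ cong fromℕQ (ℕ.*-assoc r r v) ⟨
      fromℕQ (r ℕ.* r ℕ.* v)
        ≡⟨ fromℕQ-* (r ℕ.* r) v ⟩
      fromℕQ (r ℕ.* r) * fromℕQ v
        ≡⟨ cong (fromℕQ (r ℕ.* r) *_) (IH (proj₂ a₀) (proj₂ b₀)) ⟩
      fromℕQ (r ℕ.* r) * (fromℕQ (scale s) * profile s p)
        ≡⟨ *-assoc (fromℕQ (r ℕ.* r)) (fromℕQ (scale s)) (profile s p) ⟨
      fromℕQ (r ℕ.* r) * fromℕQ (scale s) * profile s p
        ≡⟨ cong (_* profile s p) (begin
             fromℕQ (r ℕ.* r) * fromℕQ (scale s)   ≡⟨ fromℕQ-* (r ℕ.* r) (scale s) ⟨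
             fromℕQ (r ℕ.* r ℕ.* scale s)          ≡⟨ cong fromℕQ (trans (ℕ.*-assoc r r (scale s)) (sym (scale-suc s))) ⟩
             fromℕQ (scale (suc s) ℕ.* 2)          ≡⟨ fromℕQ-* (scale (suc s)) 2 ⟩
             fromℕQ (scale (suc s)) * two          ∎) ⟩
      fromℕQ (scale (suc s)) * two * profile s p
        ≡⟨ *-assoc (fromℕQ (scale (suc s))) two (profile s p) ⟩
      fromℕQ (scale (suc s)) * (two * profile s p)
        ≡⟨ cong (fromℕQ (scale (suc s)) *_) (cancel-1/suc (suc p) (two * profile s p)) ⟨
      fromℕQ (scale (suc s)) * (fromℕQ (suc (suc p)) * profile (suc s) (suc (suc p)))
        ≡⟨ solve 3 (λ a b c → a :* (b :* c) := b :* (a :* c)) refl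
             (fromℕQ (scale (suc s))) (fromℕQ (suc (suc p))) (profile (suc s) (suc (suc p))) ⟩
      fromℕQ (suc (suc p)) * (fromℕQ (scale (suc s)) * profile (suc s) (suc (suc p))) ∎)
      where
      open ≡-Reasoning
      r = suc s ℕ.+ suc s
      a₀ = fresh (IsPartialInjection.dom-unique inj) (trans (cong (ℕ._+ r) (length-map proj₁ R)) len)
      b₀ = fresh (IsPartialInjection.ran-unique inj) (trans (cong (ℕ._+ r) (length-map proj₂ R)) len)
      -- The recursion wants a natural number while the induction hypothesis gives a rational one,
      -- so the count at one fresh pair serves as reference; all other pairs agree with it by
      -- injectivity of `fromℕQ`.
      v = #ext (extend (proj₁ a₀) (proj₁ b₀) R) p
      len′ : ∀ l → l ℕ.+ (suc s ℕ.+ suc s) ≡ n → suc (suc l) ℕ.+ (s ℕ.+ s) ≡ n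
      len′ l eq = trans (solveℕ 2 (λ l s →
        con 2 ⊞ l ⊞ (s ⊞ s) ≐ l ⊞ (con 1 ⊞ s ⊞ (con 1 ⊞ s))) refl l s) eq
      IH : ∀ {a b} → a ∉ dom R → b ∉ ran R → fromℕQ (#ext (extend a b R) p) ≡ fromℕQ (scale s) * profile s p
      IH a∉ b∉ = #ext-formula s p (extend-isPartialInjection inj closed a∉ b∉) (extend-closed closed) (len′ (length R) len)

    -- Distance 2j on 2(j + k) points leaves 2k commuting points, and the empty graph leaves all
    -- points free, so that s = j + k.
    c-formula : ∀ j k → 2 ℕ.* (j ℕ.+ k) ≡ n →
      fromℕQ (c (2 ℕ.* j) β) ≡ fromℕQ (scale (j ℕ.+ k)) * (invFact k * derangements j)
    c-formula j k refl = begin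
      fromℕQ (c (2 ℕ.* j) β)                              ≡⟨ cong fromℕQ (c≡#ext (double j k)) ⟩
      fromℕQ (#ext [] (k ℕ.+ k))                          ≡⟨ #ext-formula (j ℕ.+ k) (k ℕ.+ k) ([] , []) (λ ())
                                                               (sym (cong (j ℕ.+ k ℕ.+_) (ℕ.+-identityʳ (j ℕ.+ k)))) ⟩
      fromℕQ (scale (j ℕ.+ k)) * profile (j ℕ.+ k) (k ℕ.+ k)
        ≡⟨ cong (λ i → fromℕQ (scale (j ℕ.+ k)) * profile i (k ℕ.+ k)) (ℕ.+-comm j k) ⟩
      fromℕQ (scale (j ℕ.+ k)) * profile (k ℕ.+ j) (k ℕ.+ k)
        ≡⟨ cong (fromℕQ (scale (j ℕ.+ k)) *_) (profile-even k j) ⟩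
      fromℕQ (scale (j ℕ.+ k)) * (invFact k * derangements j) ∎
      where
      open ≡-Reasoning
      double : ∀ j k → 2 ℕ.* j ℕ.+ (k ℕ.+ k) ≡ 2 ℕ.* (j ℕ.+ k)
      double = solveℕ 2 (λ j k →
        con 2 ⊠ j ⊞ (k ⊞ k) ≐ con 2 ⊠ (j ⊞ k)) refl

  [j+k]Cj*j!*k!≡[j+k]! : ∀ j k → ((j ℕ.+ k) C j) ℕ.* (j ! ℕ.* k !) ≡ (j ℕ.+ k) !
  [j+k]Cj*j!*k!≡[j+k]! j k = begin
    ((j ℕ.+ k) C j) ℕ.* (j ! ℕ.* k !)
      ≡⟨ cong (λ i → ((j ℕ.+ k) C j) ℕ.* (j ! ℕ.* i !)) (ℕ.m+n∸m≡n j k) ⟨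
    ((j ℕ.+ k) C j) ℕ.* (j ! ℕ.* (j ℕ.+ k ∸ j) !)
      ≡⟨ cong (ℕ._* (j ! ℕ.* (j ℕ.+ k ∸ j) !)) (nCk≡n!/k![n-k]! (ℕ.m≤m+n j k)) ⟩
    _ ≡⟨ ℕ.m/n*n≡m {{j ℕ.!* (j ℕ.+ k ∸ j) !≢0}} (k![n∸k]!∣n! (ℕ.m≤m+n j k)) ⟩
    (j ℕ.+ k) ! ∎
    where open ≡-Reasoning

  fromℕQ-C : ∀ j k → fromℕQ ((j ℕ.+ k) C j) ≡ fromℕQ ((j ℕ.+ k) !) * (invFact j * invFact k)
  fromℕQ-C j k = begin
    b                                             ≡⟨ *-identityʳ b ⟨
    b * (1ℚ * 1ℚ)                                 ≡⟨ cong₂ (λ x y → b * (x * y)) (invFact*n!≡1 j) (invFact*n!≡1 k) ⟨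
    b * (invFact j * fromℕQ (j !) * (invFact k * fromℕQ (k !)))
      ≡⟨ solve 5 (λ b p q r s → b :* (p :* q :* (r :* s)) := b :* (q :* s) :* (p :* r)) refl
           b (invFact j) (fromℕQ (j !)) (invFact k) (fromℕQ (k !)) ⟩
    b * (fromℕQ (j !) * fromℕQ (k !)) * (invFact j * invFact k)
      ≡⟨ cong (λ x → b * x * (invFact j * invFact k)) (fromℕQ-* (j !) (k !)) ⟨
    b * fromℕQ (j ! ℕ.* k !) * (invFact j * invFact k)
      ≡⟨ cong (_* (invFact j * invFact k)) (fromℕQ-* ((j ℕ.+ k) C j) (j ! ℕ.* k !)) ⟨
    fromℕQ (((j ℕ.+ k) C j) ℕ.* (j ! ℕ.* k !)) * (invFact j * invFact k)
      ≡⟨ cong (λ i → fromℕQ i * (invFact j * invFact k)) ([j+k]Cj*j!*k!≡[j+k]! j k) ⟩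
    fromℕQ ((j ℕ.+ k) !) * (invFact j * invFact k) ∎
    where
    open ≡-Reasoning
    b = fromℕQ ((j ℕ.+ k) C j)

  module _ {β : ∀ m → Fin (2 ℕ.* m) → Fin (2 ℕ.* m)} (fpf : ∀ m → FPFInvolution (β m)) where
    open ≡-Reasoning

    lhsS-large : ∀ {m j} → m ℕ.< j → lhsS β m j ≡ derangements j * fromℕQ (2 ℕ.^ m ℕ.* (m C j))
    lhsS-large {m} {j} m<j = begin
      fromℕQ (c (2 ℕ.* j) (β m)) * invFact m * invFact j
        ≡⟨ cong (λ i → fromℕQ i * invFact m * invFact j)
             (Extensions.c-large (β m) (fpf m) (ℕ.*-monoʳ-< 2 m<j)) ⟩
      0ℚ * invFact m * invFact j                      ≡⟨ cong (_* invFact j) (*-zeroˡ (invFact m)) ⟩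
      0ℚ * invFact j                                  ≡⟨ *-zeroˡ (invFact j) ⟩
      0ℚ                                              ≡⟨ *-zeroʳ (derangements j) ⟨
      derangements j * fromℕQ 0                       ≡⟨ cong (λ i → derangements j * fromℕQ i) (ℕ.*-zeroʳ (2 ℕ.^ m)) ⟨
      derangements j * fromℕQ (2 ℕ.^ m ℕ.* 0)         ≡⟨ cong (λ i → derangements j * fromℕQ (2 ℕ.^ m ℕ.* i)) (k>n⇒nCk≡0 m<j) ⟨
      derangements j * fromℕQ (2 ℕ.^ m ℕ.* (m C j))   ∎

    -- Of the two factors m! in `scale m`, one cancels against the weight 1 / m! and the other joins
    -- 1 / j! and 1 / k! to form the binomial coefficient.
    lhsS-small : ∀ j k → let m = j ℕ.+ k in
      lhsS β m j ≡ derangements j * fromℕQ (2 ℕ.^ m ℕ.* (m C j))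
    lhsS-small j k = begin
      fromℕQ (c (2 ℕ.* j) (β m)) * invFact m * invFact j
        ≡⟨ cong (λ a → a * invFact m * invFact j) (c-formula (β m) (fpf m) j k refl) ⟩
      fromℕQ (scale m) * (invFact k * derangements j) * invFact m * invFact j
        ≡⟨ cong (λ a → a * (invFact k * derangements j) * invFact m * invFact j)
             (trans (fromℕQ-* (2 ℕ.^ m) (m ! ℕ.* m !)) (cong (p *_) (fromℕQ-* (m !) (m !)))) ⟩
      p * (f * f) * (invFact k * derangements j) * invFact m * invFact j
        ≡⟨ solve 6 (λ p f a d b e → p :* (f :* f) :* (a :* d) :* b :* e := (b :* f) :* (d :* (p :* (f :* (e :* a))))) refl
             p f (invFact k) (derangements j) (invFact m) (invFact j) ⟩
      invFact m * f * (derangements j * (p * (f * (invFact j * invFact k))))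
        ≡⟨ cong₂ (λ a b → a * (derangements j * (p * b))) (invFact*n!≡1 m) (sym (fromℕQ-C j k)) ⟩
      1ℚ * (derangements j * (p * fromℕQ (m C j)))
        ≡⟨ *-identityˡ (derangements j * (p * fromℕQ (m C j))) ⟩
      derangements j * (p * fromℕQ (m C j))
        ≡⟨ cong (derangements j *_) (fromℕQ-* (2 ℕ.^ m) (m C j)) ⟨
      derangements j * fromℕQ (2 ℕ.^ m ℕ.* (m C j)) ∎
      where
      m = j ℕ.+ k
      p = fromℕQ (2 ℕ.^ m)
      f = fromℕQ (m !)

    lhsS-coefficient : ∀ m j → lhsS β m j ≡ derangements j * fromℕQ (2 ℕ.^ m ℕ.* (m C j))
    lhsS-coefficient m j = case ℕ.≤-<-connex j m of λ where
      (inj₁ j≤m) → subst (λ i → lhsS β i j ≡ derangements j * fromℕQ (2 ℕ.^ i ℕ.* (i C j)))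
                     (ℕ.m+[n∸m]≡n j≤m) (lhsS-small j (m ∸ j))
      (inj₂ m<j) → lhsS-large m<j

open import Data.Nat using (ℕ; _*_)
open import Data.Fin using (Fin)
open import Data.Product using (Σ; _×_; _,_)
open import Data.Rational using (1ℚ)
open import Relation.Binary.PropositionalEquality using (_≡_; refl)

-- ℚ[[z,u]] has no zero divisors, so a square root of `radicand` is determined up to sign, and the
-- constant term 1 fixes the sign. The reciprocal in the formula is expressed by a product equal to
-- 1.
theorem8 : (β : (m : ℕ) → Fin (2 * m) → Fin (2 * m)) →
    ((m : ℕ) → FPFInvolution (β m)) →
    Σ PS (λ S → (S 0 0 ≡ 1ℚ) × (S *S S ≈PS radicand) ×
    (lhsS β *S (one-2z *S S *S expPart) ≈PS oneS))
theorem8 β fpf = sqrtS , refl , sqrtS*sqrtS ,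
  inverse-of-denominator (lhsS β) (lhsS-coefficient fpf)
  where
  open BivariateSeries using (sqrtS; sqrtS*sqrtS; inverse-of-denominator)
  open Coefficients using (lhsS-coefficient)
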